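{- Let $b\ge2$ and let $OABC$ be an integer multistory completely empty marked pyramid in $\mathbb R^3$ with vertex $O$ and triangular base $ABC$, where $ABC$ is integer-affine equivalent to the triangle with vertices $(b,0),(0,-1),(0,1)$. Then $OABC$ is two-story and integer-affine equivalent to the marked pyramid $U_b$ with vertex $(0,0,0)$ and base $(2,1,b-1),(2,2,-1),(2,0,-1)$.
   Context: Integer-affine equivalence of marked pyramids: affine automorphism of $\mathbb R^3$ preserving $\mathbb Z^3$ sending vertex to vertex; a base triangle is compared with a triangle of $\mathbb R^2$ via an affine isomorphism matching integer points. Completely empty: no integer points other than the vertex and the integer points of the base. $l$-story: integer distance from vertex to the base plane equals $l$ (Euclidean distance divided by the minimal nonzero Euclidean distance to the plane of integer points in the affine span of the plane and the vertex); multistory: $l>1$. -}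

module Defs where

open import Data.Nat as ℕ using (ℕ; suc)
open import Data.Integer as ℤ using (ℤ; +_; -_; ∣_∣)
open import Data.Fin using (Fin; zero; suc)
open import Data.Product using (Σ; ∃; ∃-syntax; _×_; _,_)
open import Data.Sum using (_⊎_)
open import Function.Definitions using (Injective)
open import Relation.Binary.PropositionalEquality using (_≡_)
open import Relation.Nullary using (¬_)

record V3 : Set where
  constructor v3
  field
    x y z : ℤ
open V3 public

record V2 : Set where
  constructor v2
  field
    p q : ℤ
open V2 public

infixl 6 _+₃_ _-₃_
infixl 7 _·₃_

_+₃_ : V3 → V3 → V3
v3 a b c +₃ v3 d e f = v3 (a ℤ.+ d) (b ℤ.+ e) (c ℤ.+ f)

_-₃_ : V3 → V3 → V3
v3 a b c -₃ v3 d e f = v3 (a ℤ.- d) (b ℤ.- e) (c ℤ.- f)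

_·₃_ : ℤ → V3 → V3
k ·₃ v3 a b c = v3 (k ℤ.* a) (k ℤ.* b) (k ℤ.* c)

dot : V3 → V3 → ℤ
dot (v3 a b c) (v3 d e f) = a ℤ.* d ℤ.+ b ℤ.* e ℤ.+ c ℤ.* f

cross : V3 → V3 → V3
cross (v3 a b c) (v3 d e f) =
  v3 (b ℤ.* f ℤ.- c ℤ.* e) (c ℤ.* d ℤ.- a ℤ.* f) (a ℤ.* e ℤ.- b ℤ.* d)

det3 : V3 → V3 → V3 → ℤ
det3 u v w = dot u (cross v w)

record M3 : Set where
  constructor m3
  field
    r₁ r₂ r₃ : V3

app : M3 → V3 → V3
app (m3 r₁ r₂ r₃) v = v3 (dot r₁ v) (dot r₂ v) (dot r₃ v)

-- x ↦ M x + t is an affine automorphism of ℝ³ with f(ℤ³) = ℤ³: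
-- M is integral and has an integral inverse.
Unimodular : M3 → Set
Unimodular M = ∃[ N ] ((∀ v → app M (app N v) ≡ v) × (∀ v → app N (app M v) ≡ v))

record Pyramid : Set where
  constructor pyr
  field
    O A B C : V3
open Pyramid public

base : Pyramid → Fin 3 → V3
base P zero = A P
base P (suc zero) = B P
base P (suc (suc zero)) = C P

NonDegenerate : Pyramid → Set
NonDegenerate P = ¬ (det3 (A P -₃ O P) (B P -₃ O P) (C P -₃ O P) ≡ + 0)

PyrEquiv : Pyramid → Pyramid → Set
PyrEquiv P Q =
  Σ M3 λ M → Unimodular M × Σ V3 λ t →
    let f = λ v → app M v +₃ t in
    (f (O P) ≡ O Q) ×
    Σ (Fin 3 → Fin 3) λ σ → Injective _≡_ _≡_ σ × (∀ i → f (base P i) ≡ base Q (σ i))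

-- Integer point X lies in the closed tetrahedron conv(O,A,B,C)
-- (rational convex combination, denominators cleared: d·X = Σ nᵢ Vᵢ, Σ nᵢ = d > 0).
InPyramid : Pyramid → V3 → Set
InPyramid P X =
  ∃[ d ] ∃[ n₀ ] ∃[ n₁ ] ∃[ n₂ ] ∃[ n₃ ]
    (n₀ ℕ.+ n₁ ℕ.+ n₂ ℕ.+ n₃ ≡ suc d) ×
    ((+ suc d) ·₃ X ≡ (+ n₀) ·₃ O P +₃ (+ n₁) ·₃ A P +₃ (+ n₂) ·₃ B P +₃ (+ n₃) ·₃ C P)

InBase : Pyramid → V3 → Set
InBase P X =
  ∃[ d ] ∃[ n₁ ] ∃[ n₂ ] ∃[ n₃ ]
    (n₁ ℕ.+ n₂ ℕ.+ n₃ ≡ suc d) ×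
    ((+ suc d) ·₃ X ≡ (+ n₁) ·₃ A P +₃ (+ n₂) ·₃ B P +₃ (+ n₃) ·₃ C P)

CompletelyEmpty : Pyramid → Set
CompletelyEmpty P = ∀ X → InPyramid P X → X ≡ O P ⊎ InBase P X

-- Integer distance from the vertex to the base plane.
-- With N = (B-A)×(C-A), the Euclidean distance from an integer point X to
-- the base plane is ∣N·(X-A)∣/‖N‖, so the ratio of Euclidean distances
-- equals the ratio of the values ∣N·(X-A)∣.  The affine span of the plane
-- and the vertex is ℝ³ (nondegenerate pyramid), so X ranges over ℤ³.
planeVal : Pyramid → V3 → ℕ
planeVal P X = ∣ dot (cross (B P -₃ A P) (C P -₃ A P)) (X -₃ A P) ∣

IntDist : Pyramid → ℕ → Set
IntDist P l =
  ∃[ m ] (0 ℕ.< m) × (∃[ X ] planeVal P X ≡ m) ×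
         (∀ X → 0 ℕ.< planeVal P X → m ℕ.≤ planeVal P X) ×
         (planeVal P (O P) ≡ l ℕ.* m)

Multistory : Pyramid → Set
Multistory P = ∃[ l ] IntDist P l × 1 ℕ.< l

-- Integer-affine equivalence of the base triangle with a lattice triangle
-- of ℝ²: an affine map φ(w) = Q + p(w)·u + q(w)·v from ℝ² onto the plane
-- of the base which maps ℤ² bijectively onto the integer points of that
-- plane and maps the vertices of the plane triangle onto A, B, C.

φ : V3 → V3 → V3 → V2 → V3
φ Q u v w = Q +₃ p w ·₃ u +₃ q w ·₃ v

InBasePlane : Pyramid → V3 → Set
InBasePlane P X =
  ∃[ d ] ∃[ a ] ∃[ b ] ∃[ c ]
    (a ℤ.+ b ℤ.+ c ≡ + suc d) ×
    ((+ suc d) ·₃ X ≡ a ·₃ A P +₃ b ·₃ B P +₃ c ·₃ C P)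

BaseEquiv : Pyramid → (Fin 3 → V2) → Set
BaseEquiv P T =
  Σ V3 λ Q → Σ V3 λ u → Σ V3 λ v →
    Injective _≡_ _≡_ (φ Q u v) ×
    (∀ X → InBasePlane P X → ∃[ w ] φ Q u v w ≡ X) ×
    Σ (Fin 3 → Fin 3) λ σ → Injective _≡_ _≡_ σ × (∀ i → φ Q u v (T (σ i)) ≡ base P i)

Tri : ℕ → Fin 3 → V2
Tri b zero = v2 (+ b) (+ 0)
Tri b (suc zero) = v2 (+ 0) (- + 1)
Tri b (suc (suc zero)) = v2 (+ 0) (+ 1)

U : ℕ → Pyramid
U b = pyr (v3 (+ 0) (+ 0) (+ 0)) (v3 (+ 2) (+ 1) (+ b ℤ.- + 1))
          (v3 (+ 2) (+ 2) (- + 1)) (v3 (+ 2) (+ 0) (- + 1))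

-- Write the base plane as the image of φ(w) = Q + p u + q v and let h X = (u × v)·(X - Q), so that
-- planeVal = 2b|h|.  Cramer's rule with the apex shows that every lattice point of height 0 is in
-- the image of φ; dividing by a lattice point X₀ of minimal positive height then gives
-- ℤ³ = φ(ℤ²) + ℤ(X₀ - Q), whence |h X₀| = 1 by comparing determinants.  In the resulting unimodular
-- frame the pyramid becomes the standard one with apex (α, β, l) over (b,0,0), (0,-1,0), (0,1,0).
-- The lattice point X at height r with l X = r (α, β, l) + (x, y, 0) lies in it as soon as
-- x + b|y| ≤ b(l - r).  Taking x, y to be residues of -rα, -rβ modulo l, such a point exists at
-- height 1 or 2 unless l = 2 and α, β are odd, and for those values an explicit unimodular map
-- sends the standard pyramid onto U b.

module Submission where

open import Defs
open import Data.Nat using (ℕ; _≤_)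
open import Data.Product using (_×_)

open import Algebra.Bundles using (AbelianGroup; CommutativeSemigroup)
open import Data.Empty using (⊥; ⊥-elim)
open import Data.Fin using (Fin)
open import Data.Fin.Patterns using (0F; 1F; 2F)
open import Data.Integer as ℤ using (ℤ; +_; -[1+_]; +[1+_]; -_; _+_; _-_; _*_; ∣_∣)
import Data.Integer.DivMod as DM
import Data.Integer.Properties as ℤ
open import Data.Integer.Tactic.RingSolver using (solve-∀)
open import Data.Nat using (suc)
import Data.Nat as ℕ
import Data.Nat.Properties as ℕ
import Data.Nat.Tactic.RingSolver as NS
open import Data.Product using (∃-syntax; _,_; proj₁; proj₂)
open import Data.Sum using (_⊎_; inj₁; inj₂; [_,_]′)
open import Function.Base using (_∘_; case_of_)
open import Function.Definitions using (Injective)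
open import Level using (0ℓ)
open import Relation.Binary.Definitions using (tri<; tri≈; tri>)
open import Relation.Binary.PropositionalEquality
  using (_≡_; _≢_; refl; sym; trans; cong; cong₂; subst; subst₂; isEquivalence; module ≡-Reasoning)
open import Relation.Nullary using (contradiction)

open import Algebra.Properties.Group (AbelianGroup.group ℤ.+-0-abelianGroup) using (∙-cancelˡ; ∙-cancelʳ)

cong₃ : ∀ {A B C D : Set} (f : A → B → C → D) {a a′ b b′ c c′} →
  a ≡ a′ → b ≡ b′ → c ≡ c′ → f a b c ≡ f a′ b′ c′
cong₃ f refl refl refl = refl

+₃-comm : ∀ X Y → X +₃ Y ≡ Y +₃ X
+₃-comm (v3 a₁ a₂ a₃) (v3 b₁ b₂ b₃) = cong₃ v3 (ℤ.+-comm a₁ b₁) (ℤ.+-comm a₂ b₂) (ℤ.+-comm a₃ b₃)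

+₃-assoc : ∀ X Y Z → X +₃ Y +₃ Z ≡ X +₃ (Y +₃ Z)
+₃-assoc (v3 a₁ a₂ a₃) (v3 b₁ b₂ b₃) (v3 c₁ c₂ c₃) =
  cong₃ v3 (ℤ.+-assoc a₁ b₁ c₁) (ℤ.+-assoc a₂ b₂ c₂) (ℤ.+-assoc a₃ b₃ c₃)

+₃-commutativeSemigroup : CommutativeSemigroup 0ℓ 0ℓ
+₃-commutativeSemigroup = record
  { Carrier = V3
  ; _≈_ = _≡_
  ; _∙_ = _+₃_
  ; isCommutativeSemigroup = record
    { isSemigroup = record
      { isMagma = record { isEquivalence = isEquivalence ; ∙-cong = cong₂ _+₃_ }
      ; assoc = +₃-assoc }
    ; comm = +₃-comm } }

+₃-cancelˡ : ∀ X {Y Y′} → X +₃ Y ≡ X +₃ Y′ → Y ≡ Y′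
+₃-cancelˡ (v3 a b c) {v3 _ _ _} {v3 _ _ _} eq =
  cong₃ v3 (∙-cancelˡ a _ _ (cong x eq)) (∙-cancelˡ b _ _ (cong y eq)) (∙-cancelˡ c _ _ (cong z eq))

+₃-cancelʳ : ∀ X {Y Y′} → Y +₃ X ≡ Y′ +₃ X → Y ≡ Y′
+₃-cancelʳ (v3 a b c) {v3 _ _ _} {v3 _ _ _} eq =
  cong₃ v3 (∙-cancelʳ a _ _ (cong x eq)) (∙-cancelʳ b _ _ (cong y eq)) (∙-cancelʳ c _ _ (cong z eq))

+₃-·₃-cancel : ∀ k X Y → X ≡ X +₃ (- k) ·₃ Y +₃ k ·₃ Y
+₃-·₃-cancel k (v3 X₁ X₂ X₃) (v3 Y₁ Y₂ Y₃) = cong₃ v3 (rule k X₁ Y₁) (rule k X₂ Y₂) (rule k X₃ Y₃)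
  where
  rule : ∀ k a b → a ≡ a + - k * b + k * b
  rule = solve-∀

+₃-neg-cancel : ∀ A Z → A +₃ Z +₃ (- + 1) ·₃ A ≡ Z
+₃-neg-cancel (v3 a₁ a₂ a₃) (v3 z₁ z₂ z₃) = cong₃ v3 (rule a₁ z₁) (rule a₂ z₂) (rule a₃ z₃)
  where
  rule : ∀ a z → a + z + - + 1 * a ≡ z
  rule = solve-∀

·₃-unit : ∀ {ε} → ε * ε ≡ + 1 → ∀ k X → k ·₃ X ≡ (k * ε) ·₃ (ε ·₃ X)
·₃-unit {ε} ε²≡1 k (v3 X₁ X₂ X₃) = cong₃ v3 (unit X₁) (unit X₂) (unit X₃)
  where
  unit : ∀ a → k * a ≡ k * ε * (ε * a)
  unit a = begin
    k * a                 ≡⟨ rule₁ k a ⟩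
    k * + 1 * a           ≡⟨ cong (λ t → k * t * a) ε²≡1 ⟨
    k * (ε * ε) * a       ≡⟨ rule₂ k ε a ⟩
    k * ε * (ε * a)       ∎
    where
    open ≡-Reasoning
    rule₁ : ∀ k a → k * a ≡ k * + 1 * a
    rule₁ = solve-∀
    rule₂ : ∀ k ε a → k * (ε * ε) * a ≡ k * ε * (ε * a)
    rule₂ = solve-∀

pos-*-·₃ : ∀ m n X → + (m ℕ.* n) ·₃ X ≡ + m ·₃ (+ n ·₃ X)
pos-*-·₃ m n (v3 X₁ X₂ X₃) = cong₃ v3 (rule X₁) (rule X₂) (rule X₃)
  where
  rule : ∀ a → + (m ℕ.* n) * a ≡ + m * (+ n * a)
  rule a = trans (cong (_* a) (ℤ.pos-* m n)) (ℤ.*-assoc (+ m) (+ n) a)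

dot-·₃ʳ : ∀ N k W → dot N (k ·₃ W) ≡ k * dot N W
dot-·₃ʳ (v3 n₁ n₂ n₃) k (v3 w₁ w₂ w₃) = rule n₁ n₂ n₃ k w₁ w₂ w₃
  where
  rule : ∀ n₁ n₂ n₃ k w₁ w₂ w₃ → n₁ * (k * w₁) + n₂ * (k * w₂) + n₃ * (k * w₃) ≡ k * (n₁ * w₁ + n₂ * w₂ + n₃ * w₃)
  rule = solve-∀

det3≡dot-cross : ∀ u v W → det3 u v W ≡ dot (cross u v) W
det3≡dot-cross (v3 u₁ u₂ u₃) (v3 v₁ v₂ v₃) (v3 w₁ w₂ w₃) = rule u₁ u₂ u₃ v₁ v₂ v₃ w₁ w₂ w₃
  where
  rule : ∀ u₁ u₂ u₃ v₁ v₂ v₃ w₁ w₂ w₃ →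
    u₁ * (v₂ * w₃ - v₃ * w₂) + u₂ * (v₃ * w₁ - v₁ * w₃) + u₃ * (v₁ * w₂ - v₂ * w₁)
    ≡ (u₂ * v₃ - u₃ * v₂) * w₁ + (u₃ * v₁ - u₁ * v₃) * w₂ + (u₁ * v₂ - u₂ * v₁) * w₃
  rule = solve-∀

private
  CramerComponent : (ℤ → ℤ → ℤ → ℤ) → Set
  CramerComponent component = ∀ u₁ u₂ u₃ v₁ v₂ v₃ w₁ w₂ w₃ z₁ z₂ z₃ →
    let det : ℤ → ℤ → ℤ → ℤ → ℤ → ℤ → ℤ → ℤ → ℤ → ℤ
        det a₁ a₂ a₃ b₁ b₂ b₃ c₁ c₂ c₃ =
          a₁ * (b₂ * c₃ - b₃ * c₂) + a₂ * (b₃ * c₁ - b₁ * c₃) + a₃ * (b₁ * c₂ - b₂ * c₁)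
    in det u₁ u₂ u₃ v₁ v₂ v₃ w₁ w₂ w₃ * component z₁ z₂ z₃
       ≡ det z₁ z₂ z₃ v₁ v₂ v₃ w₁ w₂ w₃ * component u₁ u₂ u₃
         + det u₁ u₂ u₃ z₁ z₂ z₃ w₁ w₂ w₃ * component v₁ v₂ v₃
         + det u₁ u₂ u₃ v₁ v₂ v₃ z₁ z₂ z₃ * component w₁ w₂ w₃

cramer : ∀ u v W Z →
  det3 u v W ·₃ Z ≡ det3 Z v W ·₃ u +₃ det3 u Z W ·₃ v +₃ det3 u v Z ·₃ W
cramer (v3 u₁ u₂ u₃) (v3 v₁ v₂ v₃) (v3 w₁ w₂ w₃) (v3 z₁ z₂ z₃) =
  cong₃ v3 (rule₁ u₁ u₂ u₃ v₁ v₂ v₃ w₁ w₂ w₃ z₁ z₂ z₃)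
           (rule₂ u₁ u₂ u₃ v₁ v₂ v₃ w₁ w₂ w₃ z₁ z₂ z₃)
           (rule₃ u₁ u₂ u₃ v₁ v₂ v₃ w₁ w₂ w₃ z₁ z₂ z₃)
  where
  rule₁ : CramerComponent (λ a _ _ → a)
  rule₁ = solve-∀
  rule₂ : CramerComponent (λ _ b _ → b)
  rule₂ = solve-∀
  rule₃ : CramerComponent (λ _ _ c → c)
  rule₃ = solve-∀

columns : V3 → V3 → V3 → M3
columns (v3 a₁ a₂ a₃) (v3 b₁ b₂ b₃) (v3 c₁ c₂ c₃) = m3 (v3 a₁ b₁ c₁) (v3 a₂ b₂ c₂) (v3 a₃ b₃ c₃)

app-columns : ∀ a b c w → app (columns a b c) w ≡ x w ·₃ a +₃ y w ·₃ b +₃ z w ·₃ c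
app-columns (v3 a₁ a₂ a₃) (v3 b₁ b₂ b₃) (v3 c₁ c₂ c₃) (v3 s t r) =
  cong₃ v3 (rule a₁ b₁ c₁ s t r) (rule a₂ b₂ c₂ s t r) (rule a₃ b₃ c₃ s t r)
  where
  rule : ∀ a b c s t r → a * s + b * t + c * r ≡ s * a + t * b + r * c
  rule = solve-∀

app-+ : ∀ M X Y → app M (X +₃ Y) ≡ app M X +₃ app M Y
app-+ (m3 (v3 a₁ b₁ c₁) (v3 a₂ b₂ c₂) (v3 a₃ b₃ c₃)) (v3 s t r) (v3 s′ t′ r′) =
  cong₃ v3 (rule a₁ b₁ c₁ s t r s′ t′ r′) (rule a₂ b₂ c₂ s t r s′ t′ r′) (rule a₃ b₃ c₃ s t r s′ t′ r′)
  where
  rule : ∀ a b c s t r s′ t′ r′ →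
    a * (s + s′) + b * (t + t′) + c * (r + r′) ≡ a * s + b * t + c * r + (a * s′ + b * t′ + c * r′)
  rule = solve-∀

app-combination : ∀ M s t r X Y Z →
  app M (s ·₃ X +₃ t ·₃ Y +₃ r ·₃ Z) ≡ s ·₃ app M X +₃ t ·₃ app M Y +₃ r ·₃ app M Z
app-combination (m3 (v3 a₁ b₁ c₁) (v3 a₂ b₂ c₂) (v3 a₃ b₃ c₃)) s t r (v3 X₁ X₂ X₃) (v3 Y₁ Y₂ Y₃) (v3 Z₁ Z₂ Z₃) =
  cong₃ v3 (rule a₁ b₁ c₁ s t r X₁ X₂ X₃ Y₁ Y₂ Y₃ Z₁ Z₂ Z₃)
          (rule a₂ b₂ c₂ s t r X₁ X₂ X₃ Y₁ Y₂ Y₃ Z₁ Z₂ Z₃)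
          (rule a₃ b₃ c₃ s t r X₁ X₂ X₃ Y₁ Y₂ Y₃ Z₁ Z₂ Z₃)
  where
  rule : ∀ a b c s t r X₁ X₂ X₃ Y₁ Y₂ Y₃ Z₁ Z₂ Z₃ →
    a * (s * X₁ + t * Y₁ + r * Z₁) + b * (s * X₂ + t * Y₂ + r * Z₂) + c * (s * X₃ + t * Y₃ + r * Z₃)
    ≡ s * (a * X₁ + b * X₂ + c * X₃) + t * (a * Y₁ + b * Y₂ + c * Y₃) + r * (a * Z₁ + b * Z₂ + c * Z₃)
  rule = solve-∀

_ᵀ·_ : V3 → M3 → V3
r ᵀ· m3 n₁ n₂ n₃ = x r ·₃ n₁ +₃ y r ·₃ n₂ +₃ z r ·₃ n₃

mul : M3 → M3 → M3
mul (m3 r₁ r₂ r₃) N = m3 (r₁ ᵀ· N) (r₂ ᵀ· N) (r₃ ᵀ· N)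

app-mul : ∀ M N X → app (mul M N) X ≡ app M (app N X)
app-mul (m3 (v3 a₁ b₁ c₁) (v3 a₂ b₂ c₂) (v3 a₃ b₃ c₃)) (m3 (v3 p₁ q₁ r₁) (v3 p₂ q₂ r₂) (v3 p₃ q₃ r₃)) (v3 s t r) =
  cong₃ v3 (rule a₁ b₁ c₁ p₁ q₁ r₁ p₂ q₂ r₂ p₃ q₃ r₃ s t r)
          (rule a₂ b₂ c₂ p₁ q₁ r₁ p₂ q₂ r₂ p₃ q₃ r₃ s t r)
          (rule a₃ b₃ c₃ p₁ q₁ r₁ p₂ q₂ r₂ p₃ q₃ r₃ s t r)
  where
  rule : ∀ a b c p₁ q₁ r₁ p₂ q₂ r₂ p₃ q₃ r₃ s t r →
    (a * p₁ + b * p₂ + c * p₃) * s + (a * q₁ + b * q₂ + c * q₃) * t + (a * r₁ + b * r₂ + c * r₃) * r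
    ≡ a * (p₁ * s + q₁ * t + r₁ * r) + b * (p₂ * s + q₂ * t + r₂ * r) + c * (p₃ * s + q₃ * t + r₃ * r)
  rule = solve-∀

Unimodular-mul : ∀ M N → Unimodular M → Unimodular N → Unimodular (mul M N)
Unimodular-mul M N (M⁻¹ , MM⁻¹ , M⁻¹M) (N⁻¹ , NN⁻¹ , N⁻¹N) = mul N⁻¹ M⁻¹ , right , left
  where
  open ≡-Reasoning
  right : ∀ v → app (mul M N) (app (mul N⁻¹ M⁻¹) v) ≡ v
  right v = begin
    app (mul M N) (app (mul N⁻¹ M⁻¹) v) ≡⟨ app-mul M N _ ⟩
    app M (app N (app (mul N⁻¹ M⁻¹) v)) ≡⟨ cong (app M ∘ app N) (app-mul N⁻¹ M⁻¹ v) ⟩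
    app M (app N (app N⁻¹ (app M⁻¹ v))) ≡⟨ cong (app M) (NN⁻¹ _) ⟩
    app M (app M⁻¹ v)                   ≡⟨ MM⁻¹ v ⟩
    v                                   ∎
  left : ∀ v → app (mul N⁻¹ M⁻¹) (app (mul M N) v) ≡ v
  left v = begin
    app (mul N⁻¹ M⁻¹) (app (mul M N) v) ≡⟨ app-mul N⁻¹ M⁻¹ _ ⟩
    app N⁻¹ (app M⁻¹ (app (mul M N) v)) ≡⟨ cong (app N⁻¹ ∘ app M⁻¹) (app-mul M N v) ⟩
    app N⁻¹ (app M⁻¹ (app M (app N v))) ≡⟨ cong (app N⁻¹) (M⁻¹M _) ⟩
    app N⁻¹ (app N v)                   ≡⟨ N⁻¹N v ⟩
    v                                   ∎

PyrEquiv-trans : ∀ {P Q R} → PyrEquiv P Q → PyrEquiv Q R → PyrEquiv P R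
PyrEquiv-trans {P} (M , M-unimodular , t , fO , σ , σ-injective , f-base)
                   (N , N-unimodular , s , gO , τ , τ-injective , g-base) =
  mul N M , Unimodular-mul N M N-unimodular M-unimodular , app N t +₃ s ,
  trans (composite (O P)) (trans (cong g fO) gO) ,
  τ ∘ σ , σ-injective ∘ τ-injective ,
  λ i → trans (composite (base P i)) (trans (cong g (f-base i)) (g-base (σ i)))
  where
  g : V3 → V3
  g X = app N X +₃ s
  composite : ∀ X → app (mul N M) X +₃ (app N t +₃ s) ≡ g (app M X +₃ t)
  composite X = begin
    app (mul N M) X +₃ (app N t +₃ s)     ≡⟨ cong (_+₃ (app N t +₃ s)) (app-mul N M X) ⟩
    app N (app M X) +₃ (app N t +₃ s)     ≡⟨ +₃-assoc (app N (app M X)) (app N t) s ⟨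
    app N (app M X) +₃ app N t +₃ s       ≡⟨ cong (_+₃ s) (app-+ N (app M X) t) ⟨
    g (app M X +₃ t)                      ∎
    where open ≡-Reasoning

e₁ e₂ e₃ : V3
e₁ = v3 (+ 1) (+ 0) (+ 0)
e₂ = v3 (+ 0) (+ 1) (+ 0)
e₃ = v3 (+ 0) (+ 0) (+ 1)

basis-expansion : ∀ Z → x Z ·₃ e₁ +₃ y Z ·₃ e₂ +₃ z Z ·₃ e₃ ≡ Z
basis-expansion (v3 a b c) = cong₃ v3 (rule₁ a b c) (rule₂ a b c) (rule₃ a b c)
  where
  rule₁ : ∀ a b c → a * + 1 + b * + 0 + c * + 0 ≡ a
  rule₁ = solve-∀
  rule₂ : ∀ a b c → a * + 0 + b * + 1 + c * + 0 ≡ b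
  rule₂ = solve-∀
  rule₃ : ∀ a b c → a * + 0 + b * + 0 + c * + 1 ≡ c
  rule₃ = solve-∀

bijective⇒unimodular : ∀ G → (∀ {w w′} → app G w ≡ app G w′ → w ≡ w′) →
  (∀ Z → ∃[ w ] app G w ≡ Z) → Unimodular G
bijective⇒unimodular G injective surjective = H , GH , λ w → injective (GH (app G w))
  where
  preimage : V3 → V3
  preimage Z = proj₁ (surjective Z)
  H : M3
  H = columns (preimage e₁) (preimage e₂) (preimage e₃)
  GH : ∀ Z → app G (app H Z) ≡ Z
  GH Z = begin
    app G (app H Z)
      ≡⟨ cong (app G) (app-columns (preimage e₁) (preimage e₂) (preimage e₃) Z) ⟩
    app G (x Z ·₃ preimage e₁ +₃ y Z ·₃ preimage e₂ +₃ z Z ·₃ preimage e₃)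
      ≡⟨ app-combination G (x Z) (y Z) (z Z) (preimage e₁) (preimage e₂) (preimage e₃) ⟩
    x Z ·₃ app G (preimage e₁) +₃ y Z ·₃ app G (preimage e₂) +₃ z Z ·₃ app G (preimage e₃)
      ≡⟨ cong₃ (λ X Y W → x Z ·₃ X +₃ y Z ·₃ Y +₃ z Z ·₃ W)
               (proj₂ (surjective e₁)) (proj₂ (surjective e₂)) (proj₂ (surjective e₃)) ⟩
    x Z ·₃ e₁ +₃ y Z ·₃ e₂ +₃ z Z ·₃ e₃
      ≡⟨ basis-expansion Z ⟩
    Z ∎
    where open ≡-Reasoning

det3-columns : ∀ a b c w₁ w₂ w₃ →
  det3 (app (columns a b c) w₁) (app (columns a b c) w₂) (app (columns a b c) w₃)
  ≡ det3 a b c * det3 w₁ w₂ w₃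
det3-columns (v3 a₁ a₂ a₃) (v3 b₁ b₂ b₃) (v3 c₁ c₂ c₃) (v3 s₁ t₁ r₁) (v3 s₂ t₂ r₂) (v3 s₃ t₃ r₃) =
  rule a₁ a₂ a₃ b₁ b₂ b₃ c₁ c₂ c₃ s₁ t₁ r₁ s₂ t₂ r₂ s₃ t₃ r₃
  where
  rule : ∀ a₁ a₂ a₃ b₁ b₂ b₃ c₁ c₂ c₃ s₁ t₁ r₁ s₂ t₂ r₂ s₃ t₃ r₃ →
    let det : ℤ → ℤ → ℤ → ℤ → ℤ → ℤ → ℤ → ℤ → ℤ → ℤ
        det p₁ p₂ p₃ q₁ q₂ q₃ r₁ r₂ r₃ =
          p₁ * (q₂ * r₃ - q₃ * r₂) + p₂ * (q₃ * r₁ - q₁ * r₃) + p₃ * (q₁ * r₂ - q₂ * r₁)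
        row : ℤ → ℤ → ℤ → ℤ → ℤ → ℤ → ℤ
        row a b c s t r = a * s + b * t + c * r
    in det (row a₁ b₁ c₁ s₁ t₁ r₁) (row a₂ b₂ c₂ s₁ t₁ r₁) (row a₃ b₃ c₃ s₁ t₁ r₁)
           (row a₁ b₁ c₁ s₂ t₂ r₂) (row a₂ b₂ c₂ s₂ t₂ r₂) (row a₃ b₃ c₃ s₂ t₂ r₂)
           (row a₁ b₁ c₁ s₃ t₃ r₃) (row a₂ b₂ c₂ s₃ t₃ r₃) (row a₃ b₃ c₃ s₃ t₃ r₃)
       ≡ det a₁ a₂ a₃ b₁ b₂ b₃ c₁ c₂ c₃ * det s₁ t₁ r₁ s₂ t₂ r₂ s₃ t₃ r₃
  rule = solve-∀

surjective⇒det-unit : ∀ a b c → (∀ Z → ∃[ w ] app (columns a b c) w ≡ Z) →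
  ∃[ k ] det3 a b c * k ≡ + 1
surjective⇒det-unit a b c surjective
  with surjective e₁ | surjective e₂ | surjective e₃
... | w₁ , Gw₁≡e₁ | w₂ , Gw₂≡e₂ | w₃ , Gw₃≡e₃ =
  det3 w₁ w₂ w₃ , trans (sym (det3-columns a b c w₁ w₂ w₃)) (cong₃ det3 Gw₁≡e₁ Gw₂≡e₂ Gw₃≡e₃)

data IsPerm : Fin 3 → Fin 3 → Fin 3 → Set where
  p012 : IsPerm 0F 1F 2F
  p021 : IsPerm 0F 2F 1F
  p102 : IsPerm 1F 0F 2F
  p120 : IsPerm 1F 2F 0F
  p201 : IsPerm 2F 0F 1F
  p210 : IsPerm 2F 1F 0F

distinct⇒IsPerm : ∀ i j k → i ≢ j → i ≢ k → j ≢ k → IsPerm i j k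
distinct⇒IsPerm 0F 1F 2F _ _ _ = p012
distinct⇒IsPerm 0F 2F 1F _ _ _ = p021
distinct⇒IsPerm 1F 0F 2F _ _ _ = p102
distinct⇒IsPerm 1F 2F 0F _ _ _ = p120
distinct⇒IsPerm 2F 0F 1F _ _ _ = p201
distinct⇒IsPerm 2F 1F 0F _ _ _ = p210
distinct⇒IsPerm 0F 0F _  i≢j _ _ = contradiction refl i≢j
distinct⇒IsPerm 1F 1F _  i≢j _ _ = contradiction refl i≢j
distinct⇒IsPerm 2F 2F _  i≢j _ _ = contradiction refl i≢j
distinct⇒IsPerm 0F _  0F _ i≢k _ = contradiction refl i≢k
distinct⇒IsPerm 1F _  1F _ i≢k _ = contradiction refl i≢k
distinct⇒IsPerm 2F _  2F _ i≢k _ = contradiction refl i≢k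
distinct⇒IsPerm _  0F 0F _ _ j≢k = contradiction refl j≢k
distinct⇒IsPerm _  1F 1F _ _ j≢k = contradiction refl j≢k
distinct⇒IsPerm _  2F 2F _ _ j≢k = contradiction refl j≢k

injective⇒IsPerm : (σ : Fin 3 → Fin 3) → Injective _≡_ _≡_ σ → IsPerm (σ 0F) (σ 1F) (σ 2F)
injective⇒IsPerm σ σ-injective = distinct⇒IsPerm _ _ _
  (λ eq → case σ-injective eq of λ ()) (λ eq → case σ-injective eq of λ ())
  (λ eq → case σ-injective eq of λ ())

module _ (S : CommutativeSemigroup 0ℓ 0ℓ) where
  open CommutativeSemigroup S using (Carrier; _≈_; _∙_; assoc; ∙-congˡ; setoid)
    renaming (refl to ≈-refl)
  open import Algebra.Properties.CommutativeSemigroup S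
  open import Relation.Binary.Reasoning.Setoid setoid

  ∙-permute : ∀ {i j k} → IsPerm i j k → (f : Fin 3 → Carrier) →
    f i ∙ f j ∙ f k ≈ f 0F ∙ f 1F ∙ f 2F
  ∙-permute p012 f = ≈-refl
  ∙-permute p021 f = xy∙z≈xz∙y (f 0F) (f 2F) (f 1F)
  ∙-permute p102 f = xy∙z≈yx∙z (f 1F) (f 0F) (f 2F)
  ∙-permute p120 f = xy∙z≈zx∙y (f 1F) (f 2F) (f 0F)
  ∙-permute p201 f = xy∙z≈yz∙x (f 2F) (f 0F) (f 1F)
  ∙-permute p210 f = xy∙z≈zy∙x (f 2F) (f 1F) (f 0F)

  ∙-permuteʳ : ∀ {i j k} → IsPerm i j k → ∀ a (f : Fin 3 → Carrier) →
    a ∙ f i ∙ f j ∙ f k ≈ a ∙ f 0F ∙ f 1F ∙ f 2F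
  ∙-permuteʳ {i} {j} {k} π a f = begin
    a ∙ f i ∙ f j ∙ f k          ≈⟨ regroup (f i) (f j) (f k) ⟩
    a ∙ (f i ∙ f j ∙ f k)        ≈⟨ ∙-congˡ (∙-permute π f) ⟩
    a ∙ (f 0F ∙ f 1F ∙ f 2F)     ≈⟨ regroup (f 0F) (f 1F) (f 2F) ⟨
    a ∙ f 0F ∙ f 1F ∙ f 2F       ∎
    where
    regroup : ∀ b c d → a ∙ b ∙ c ∙ d ≈ a ∙ (b ∙ c ∙ d)
    regroup b c d = begin
      a ∙ b ∙ c ∙ d     ≈⟨ assoc (a ∙ b) c d ⟩
      a ∙ b ∙ (c ∙ d)   ≈⟨ assoc a b (c ∙ d) ⟩
      a ∙ (b ∙ (c ∙ d)) ≈⟨ ∙-congˡ (assoc b c d) ⟨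
      a ∙ (b ∙ c ∙ d)   ∎

lift : V2 → V3
lift (v2 s t) = v3 s t (+ 0)

frame-φ : ∀ Q u v W a c r → Q +₃ app (columns u v W) (v3 a c r) ≡ φ Q u v (v2 a c) +₃ r ·₃ W
frame-φ (v3 Q₁ Q₂ Q₃) (v3 u₁ u₂ u₃) (v3 v₁ v₂ v₃) (v3 w₁ w₂ w₃) a c r =
  cong₃ v3 (rule Q₁ u₁ v₁ w₁ a c r) (rule Q₂ u₂ v₂ w₂ a c r) (rule Q₃ u₃ v₃ w₃ a c r)
  where
  rule : ∀ Q u v w a c r → Q + (u * a + v * c + w * r) ≡ Q + a * u + c * v + r * w
  rule = solve-∀

frame-lift : ∀ Q u v W w → Q +₃ app (columns u v W) (lift w) ≡ φ Q u v w
frame-lift Q u v W (v2 a c) = trans (frame-φ Q u v W a c (+ 0)) (+₃-zero (φ Q u v (v2 a c)) W)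
  where
  +₃-zero : ∀ X W → X +₃ + 0 ·₃ W ≡ X
  +₃-zero (v3 X₁ X₂ X₃) (v3 w₁ w₂ w₃) = cong₃ v3 (ℤ.+-identityʳ X₁) (ℤ.+-identityʳ X₂) (ℤ.+-identityʳ X₃)

affine-combination : ∀ Q M {k X} n₀ n₁ n₂ n₃ V₀ V₁ V₂ V₃ → n₀ + n₁ + n₂ + n₃ ≡ k →
  k ·₃ X ≡ n₀ ·₃ V₀ +₃ n₁ ·₃ V₁ +₃ n₂ ·₃ V₂ +₃ n₃ ·₃ V₃ →
  k ·₃ (Q +₃ app M X) ≡ n₀ ·₃ (Q +₃ app M V₀) +₃ n₁ ·₃ (Q +₃ app M V₁) +₃ n₂ ·₃ (Q +₃ app M V₂)
                         +₃ n₃ ·₃ (Q +₃ app M V₃)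
affine-combination Q M {k} {X} n₀ n₁ n₂ n₃ V₀ V₁ V₂ V₃ sum eq = begin
  k ·₃ (Q +₃ app M X)                     ≡⟨ distribute Q M k X ⟩
  k ·₃ Q +₃ app M (k ·₃ X)                ≡⟨ cong₂ (λ k Y → k ·₃ Q +₃ app M Y) (sym sum) eq ⟩
  (n₀ + n₁ + n₂ + n₃) ·₃ Q +₃ app M (n₀ ·₃ V₀ +₃ n₁ ·₃ V₁ +₃ n₂ ·₃ V₂ +₃ n₃ ·₃ V₃)
                                          ≡⟨ collect Q M V₀ V₁ V₂ V₃ ⟩
  _                                       ∎
  where
  open ≡-Reasoning
  distribute : ∀ Q M k X → k ·₃ (Q +₃ app M X) ≡ k ·₃ Q +₃ app M (k ·₃ X)
  distribute (v3 Q₁ Q₂ Q₃) (m3 (v3 a₁ b₁ c₁) (v3 a₂ b₂ c₂) (v3 a₃ b₃ c₃)) k (v3 X₁ X₂ X₃) =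
    cong₃ v3 (rule Q₁ a₁ b₁ c₁ k X₁ X₂ X₃) (rule Q₂ a₂ b₂ c₂ k X₁ X₂ X₃) (rule Q₃ a₃ b₃ c₃ k X₁ X₂ X₃)
    where
    rule : ∀ q a b c k X₁ X₂ X₃ →
      k * (q + (a * X₁ + b * X₂ + c * X₃)) ≡ k * q + (a * (k * X₁) + b * (k * X₂) + c * (k * X₃))
    rule = solve-∀
  collect : ∀ Q M V₀ V₁ V₂ V₃ →
    (n₀ + n₁ + n₂ + n₃) ·₃ Q +₃ app M (n₀ ·₃ V₀ +₃ n₁ ·₃ V₁ +₃ n₂ ·₃ V₂ +₃ n₃ ·₃ V₃)
    ≡ n₀ ·₃ (Q +₃ app M V₀) +₃ n₁ ·₃ (Q +₃ app M V₁) +₃ n₂ ·₃ (Q +₃ app M V₂) +₃ n₃ ·₃ (Q +₃ app M V₃)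
  collect (v3 Q₁ Q₂ Q₃) (m3 (v3 a₁ b₁ c₁) (v3 a₂ b₂ c₂) (v3 a₃ b₃ c₃))
          (v3 s₀ t₀ r₀) (v3 s₁ t₁ r₁) (v3 s₂ t₂ r₂) (v3 s₃ t₃ r₃) =
    cong₃ v3 (rule Q₁ a₁ b₁ c₁ n₀ n₁ n₂ n₃ s₀ t₀ r₀ s₁ t₁ r₁ s₂ t₂ r₂ s₃ t₃ r₃)
             (rule Q₂ a₂ b₂ c₂ n₀ n₁ n₂ n₃ s₀ t₀ r₀ s₁ t₁ r₁ s₂ t₂ r₂ s₃ t₃ r₃)
             (rule Q₃ a₃ b₃ c₃ n₀ n₁ n₂ n₃ s₀ t₀ r₀ s₁ t₁ r₁ s₂ t₂ r₂ s₃ t₃ r₃)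
    where
    rule : ∀ q a b c n₀ n₁ n₂ n₃ s₀ t₀ r₀ s₁ t₁ r₁ s₂ t₂ r₂ s₃ t₃ r₃ →
      let image : ℤ → ℤ → ℤ → ℤ
          image s t r = q + (a * s + b * t + c * r)
      in (n₀ + n₁ + n₂ + n₃) * q
         + (a * (n₀ * s₀ + n₁ * s₁ + n₂ * s₂ + n₃ * s₃) + b * (n₀ * t₀ + n₁ * t₁ + n₂ * t₂ + n₃ * t₃)
            + c * (n₀ * r₀ + n₁ * r₁ + n₂ * r₂ + n₃ * r₃))
         ≡ n₀ * image s₀ t₀ r₀ + n₁ * image s₁ t₁ r₁ + n₂ * image s₂ t₂ r₂ + n₃ * image s₃ t₃ r₃
    rule = solve-∀

InPyramid-affine : ∀ Q M {O₁ O₂ X} (V₁ V₂ : Fin 3 → V3) {i j k} → IsPerm i j k →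
  Q +₃ app M O₁ ≡ O₂ → (∀ n → Q +₃ app M (V₁ n) ≡ V₂ n) →
  InPyramid (pyr O₁ (V₁ 0F) (V₁ 1F) (V₁ 2F)) X → InPyramid (pyr O₂ (V₂ i) (V₂ j) (V₂ k)) (Q +₃ app M X)
InPyramid-affine Q M {O₁} {O₂} {X} V₁ V₂ {i} {j} {k} π image-O image-V (d , n₀ , n₁ , n₂ , n₃ , sum , eq) =
  d , n₀ , c i , c j , c k , trans (∙-permuteʳ ℕ.+-commutativeSemigroup π n₀ c) sum , (begin
    + suc d ·₃ F X
      ≡⟨ affine-combination Q M (+ n₀) (+ n₁) (+ n₂) (+ n₃) O₁ (V₁ 0F) (V₁ 1F) (V₁ 2F) weight eq ⟩
    + n₀ ·₃ F O₁ +₃ + n₁ ·₃ F (V₁ 0F) +₃ + n₂ ·₃ F (V₁ 1F) +₃ + n₃ ·₃ F (V₁ 2F)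
      ≡⟨ cong (λ O → combination O (F (V₁ 0F)) (F (V₁ 1F)) (F (V₁ 2F))) image-O ⟩
    + n₀ ·₃ O₂ +₃ + n₁ ·₃ F (V₁ 0F) +₃ + n₂ ·₃ F (V₁ 1F) +₃ + n₃ ·₃ F (V₁ 2F)
      ≡⟨ cong₃ (combination O₂) (image-V 0F) (image-V 1F) (image-V 2F) ⟩
    + n₀ ·₃ O₂ +₃ + c 0F ·₃ V₂ 0F +₃ + c 1F ·₃ V₂ 1F +₃ + c 2F ·₃ V₂ 2F
      ≡⟨ ∙-permuteʳ +₃-commutativeSemigroup π (+ n₀ ·₃ O₂) (λ n → + c n ·₃ V₂ n) ⟨
    + n₀ ·₃ O₂ +₃ + c i ·₃ V₂ i +₃ + c j ·₃ V₂ j +₃ + c k ·₃ V₂ k ∎)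
  where
  open ≡-Reasoning
  F : V3 → V3
  F Y = Q +₃ app M Y
  combination : V3 → V3 → V3 → V3 → V3
  combination O A B C = + n₀ ·₃ O +₃ + n₁ ·₃ A +₃ + n₂ ·₃ B +₃ + n₃ ·₃ C
  c : Fin 3 → ℕ
  c 0F = n₁
  c 1F = n₂
  c 2F = n₃
  weight : + n₀ + + n₁ + + n₂ + + n₃ ≡ + suc d
  weight = cong +_ sum

-- Heights over a lattice plane

det2 : V2 → V2 → V2 → ℤ
det2 w₀ w₁ w₂ = (p w₁ - p w₀) * (q w₂ - q w₀) - (q w₁ - q w₀) * (p w₂ - p w₀)

∣det2∣-swap₀₁ : ∀ w₀ w₁ w₂ → ∣ det2 w₁ w₀ w₂ ∣ ≡ ∣ det2 w₀ w₁ w₂ ∣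
∣det2∣-swap₀₁ (v2 a₀ b₀) (v2 a₁ b₁) (v2 a₂ b₂) =
  trans (cong ∣_∣ (rule a₀ b₀ a₁ b₁ a₂ b₂)) (ℤ.∣-i∣≡∣i∣ (det2 (v2 a₀ b₀) (v2 a₁ b₁) (v2 a₂ b₂)))
  where
  rule : ∀ a₀ b₀ a₁ b₁ a₂ b₂ →
    (a₀ - a₁) * (b₂ - b₁) - (b₀ - b₁) * (a₂ - a₁) ≡ - ((a₁ - a₀) * (b₂ - b₀) - (b₁ - b₀) * (a₂ - a₀))
  rule = solve-∀

∣det2∣-swap₁₂ : ∀ w₀ w₁ w₂ → ∣ det2 w₀ w₂ w₁ ∣ ≡ ∣ det2 w₀ w₁ w₂ ∣
∣det2∣-swap₁₂ (v2 a₀ b₀) (v2 a₁ b₁) (v2 a₂ b₂) =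
  trans (cong ∣_∣ (rule a₀ b₀ a₁ b₁ a₂ b₂)) (ℤ.∣-i∣≡∣i∣ (det2 (v2 a₀ b₀) (v2 a₁ b₁) (v2 a₂ b₂)))
  where
  rule : ∀ a₀ b₀ a₁ b₁ a₂ b₂ →
    (a₂ - a₀) * (b₁ - b₀) - (b₂ - b₀) * (a₁ - a₀) ≡ - ((a₁ - a₀) * (b₂ - b₀) - (b₁ - b₀) * (a₂ - a₀))
  rule = solve-∀

∣det2∣-permute : ∀ {i j k} → IsPerm i j k → (w : Fin 3 → V2) →
  ∣ det2 (w i) (w j) (w k) ∣ ≡ ∣ det2 (w 0F) (w 1F) (w 2F) ∣
∣det2∣-permute p012 w = refl
∣det2∣-permute p021 w = ∣det2∣-swap₁₂ (w 0F) (w 1F) (w 2F)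
∣det2∣-permute p102 w = ∣det2∣-swap₀₁ (w 0F) (w 1F) (w 2F)
∣det2∣-permute p120 w = trans (∣det2∣-swap₁₂ (w 1F) (w 0F) (w 2F)) (∣det2∣-swap₀₁ (w 0F) (w 1F) (w 2F))
∣det2∣-permute p201 w = trans (∣det2∣-swap₀₁ (w 0F) (w 2F) (w 1F)) (∣det2∣-swap₁₂ (w 0F) (w 1F) (w 2F))
∣det2∣-permute p210 w = trans (∣det2∣-swap₁₂ (w 2F) (w 0F) (w 1F)) (∣det2∣-permute p201 w)

height : V3 → V3 → V3 → V3 → ℤ
height Q u v X = dot (cross u v) (X -₃ Q)

height-φ : ∀ Q u v w → height Q u v (φ Q u v w) ≡ + 0
height-φ (v3 Q₁ Q₂ Q₃) (v3 u₁ u₂ u₃) (v3 v₁ v₂ v₃) (v2 s t) = rule Q₁ Q₂ Q₃ u₁ u₂ u₃ v₁ v₂ v₃ s t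
  where
  rule : ∀ Q₁ Q₂ Q₃ u₁ u₂ u₃ v₁ v₂ v₃ s t →
    (u₂ * v₃ - u₃ * v₂) * (Q₁ + s * u₁ + t * v₁ - Q₁) + (u₃ * v₁ - u₁ * v₃) * (Q₂ + s * u₂ + t * v₂ - Q₂)
    + (u₁ * v₂ - u₂ * v₁) * (Q₃ + s * u₃ + t * v₃ - Q₃) ≡ + 0
  rule = solve-∀

height-translate : ∀ Q u v X k W → height Q u v (X +₃ k ·₃ W) ≡ height Q u v X + k * dot (cross u v) W
height-translate (v3 Q₁ Q₂ Q₃) (v3 u₁ u₂ u₃) (v3 v₁ v₂ v₃) (v3 X₁ X₂ X₃) k (v3 w₁ w₂ w₃) =
  rule Q₁ Q₂ Q₃ u₁ u₂ u₃ v₁ v₂ v₃ X₁ X₂ X₃ k w₁ w₂ w₃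
  where
  rule : ∀ Q₁ Q₂ Q₃ u₁ u₂ u₃ v₁ v₂ v₃ X₁ X₂ X₃ k w₁ w₂ w₃ →
    let n₁ = u₂ * v₃ - u₃ * v₂ ; n₂ = u₃ * v₁ - u₁ * v₃ ; n₃ = u₁ * v₂ - u₂ * v₁
    in n₁ * (X₁ + k * w₁ - Q₁) + n₂ * (X₂ + k * w₂ - Q₂) + n₃ * (X₃ + k * w₃ - Q₃)
       ≡ n₁ * (X₁ - Q₁) + n₂ * (X₂ - Q₂) + n₃ * (X₃ - Q₃) + k * (n₁ * w₁ + n₂ * w₂ + n₃ * w₃)
  rule = solve-∀

triple-φ : ∀ Q u v X w₀ w₁ w₂ →
  dot (cross (φ Q u v w₁ -₃ φ Q u v w₀) (φ Q u v w₂ -₃ φ Q u v w₀)) (X -₃ φ Q u v w₀)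
  ≡ det2 w₀ w₁ w₂ * height Q u v X
triple-φ (v3 Q₁ Q₂ Q₃) (v3 u₁ u₂ u₃) (v3 v₁ v₂ v₃) (v3 X₁ X₂ X₃) (v2 s₀ t₀) (v2 s₁ t₁) (v2 s₂ t₂) =
  rule Q₁ Q₂ Q₃ u₁ u₂ u₃ v₁ v₂ v₃ X₁ X₂ X₃ s₀ t₀ s₁ t₁ s₂ t₂
  where
  rule : ∀ Q₁ Q₂ Q₃ u₁ u₂ u₃ v₁ v₂ v₃ X₁ X₂ X₃ s₀ t₀ s₁ t₁ s₂ t₂ →
    let triple : ℤ → ℤ → ℤ → ℤ → ℤ → ℤ → ℤ → ℤ → ℤ → ℤ
        triple a₁ a₂ a₃ b₁ b₂ b₃ c₁ c₂ c₃ =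
          (a₂ * b₃ - a₃ * b₂) * c₁ + (a₃ * b₁ - a₁ * b₃) * c₂ + (a₁ * b₂ - a₂ * b₁) * c₃
        f₁ : ℤ → ℤ → ℤ
        f₁ s t = Q₁ + s * u₁ + t * v₁
        f₂ : ℤ → ℤ → ℤ
        f₂ s t = Q₂ + s * u₂ + t * v₂
        f₃ : ℤ → ℤ → ℤ
        f₃ s t = Q₃ + s * u₃ + t * v₃
    in triple (f₁ s₁ t₁ - f₁ s₀ t₀) (f₂ s₁ t₁ - f₂ s₀ t₀) (f₃ s₁ t₁ - f₃ s₀ t₀)
              (f₁ s₂ t₂ - f₁ s₀ t₀) (f₂ s₂ t₂ - f₂ s₀ t₀) (f₃ s₂ t₂ - f₃ s₀ t₀)
              (X₁ - f₁ s₀ t₀) (X₂ - f₂ s₀ t₀) (X₃ - f₃ s₀ t₀)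
       ≡ ((s₁ - s₀) * (t₂ - t₀) - (t₁ - t₀) * (s₂ - s₀))
         * triple u₁ u₂ u₃ v₁ v₂ v₃ (X₁ - Q₁) (X₂ - Q₂) (X₃ - Q₃)
  rule = solve-∀

planeVal-φ : ∀ O Q u v w₀ w₁ w₂ X →
  planeVal (pyr O (φ Q u v w₀) (φ Q u v w₁) (φ Q u v w₂)) X ≡ ∣ det2 w₀ w₁ w₂ ∣ ℕ.* ∣ height Q u v X ∣
planeVal-φ O Q u v w₀ w₁ w₂ X =
  trans (cong ∣_∣ (triple-φ Q u v X w₀ w₁ w₂)) (ℤ.abs-* (det2 w₀ w₁ w₂) (height Q u v X))

scaled-height : ∀ Q u v X k → k * height Q u v X ≡ dot (cross u v) (k ·₃ X -₃ k ·₃ Q)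
scaled-height (v3 Q₁ Q₂ Q₃) (v3 u₁ u₂ u₃) (v3 v₁ v₂ v₃) (v3 X₁ X₂ X₃) k =
  rule Q₁ Q₂ Q₃ u₁ u₂ u₃ v₁ v₂ v₃ X₁ X₂ X₃ k
  where
  rule : ∀ Q₁ Q₂ Q₃ u₁ u₂ u₃ v₁ v₂ v₃ X₁ X₂ X₃ k →
    let n₁ = u₂ * v₃ - u₃ * v₂ ; n₂ = u₃ * v₁ - u₁ * v₃ ; n₃ = u₁ * v₂ - u₂ * v₁
    in k * (n₁ * (X₁ - Q₁) + n₂ * (X₂ - Q₂) + n₃ * (X₃ - Q₃))
       ≡ n₁ * (k * X₁ - k * Q₁) + n₂ * (k * X₂ - k * Q₂) + n₃ * (k * X₃ - k * Q₃)
  rule = solve-∀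

height-φ-combination : ∀ Q u v w₀ w₁ w₂ a b c →
  dot (cross u v) (a ·₃ φ Q u v w₀ +₃ b ·₃ φ Q u v w₁ +₃ c ·₃ φ Q u v w₂ -₃ (a + b + c) ·₃ Q) ≡ + 0
height-φ-combination (v3 Q₁ Q₂ Q₃) (v3 u₁ u₂ u₃) (v3 v₁ v₂ v₃) (v2 s₀ t₀) (v2 s₁ t₁) (v2 s₂ t₂) a b c =
  rule Q₁ Q₂ Q₃ u₁ u₂ u₃ v₁ v₂ v₃ s₀ t₀ s₁ t₁ s₂ t₂ a b c
  where
  rule : ∀ Q₁ Q₂ Q₃ u₁ u₂ u₃ v₁ v₂ v₃ s₀ t₀ s₁ t₁ s₂ t₂ a b c →
    let combination : ℤ → ℤ → ℤ → ℤ
        combination Q u v = a * (Q + s₀ * u + t₀ * v) + b * (Q + s₁ * u + t₁ * v)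
                            + c * (Q + s₂ * u + t₂ * v) - (a + b + c) * Q
    in (u₂ * v₃ - u₃ * v₂) * combination Q₁ u₁ v₁ + (u₃ * v₁ - u₁ * v₃) * combination Q₂ u₂ v₂
       + (u₁ * v₂ - u₂ * v₁) * combination Q₃ u₃ v₃ ≡ + 0
  rule = solve-∀

height-inBase : ∀ O Q u v w₀ w₁ w₂ X →
  InBase (pyr O (φ Q u v w₀) (φ Q u v w₁) (φ Q u v w₂)) X → height Q u v X ≡ + 0
height-inBase O Q u v w₀ w₁ w₂ X (d , n₁ , n₂ , n₃ , sum , eq) =
  ℤ.*-cancelˡ-≡ (+ suc d) (height Q u v X) (+ 0) (trans scaled-height-vanishes (sym (ℤ.*-zeroʳ (+ suc d))))
  where
  N = cross u v
  weight : + suc d ≡ + n₁ + + n₂ + + n₃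
  weight = cong +_ (sym sum)
  scaled-height-vanishes : + suc d * height Q u v X ≡ + 0
  scaled-height-vanishes = begin
    + suc d * height Q u v X
      ≡⟨ scaled-height Q u v X (+ suc d) ⟩
    dot N (+ suc d ·₃ X -₃ + suc d ·₃ Q)
      ≡⟨ cong₂ (λ Y k → dot N (Y -₃ k ·₃ Q)) eq weight ⟩
    dot N (+ n₁ ·₃ φ Q u v w₀ +₃ + n₂ ·₃ φ Q u v w₁ +₃ + n₃ ·₃ φ Q u v w₂ -₃ (+ n₁ + + n₂ + + n₃) ·₃ Q)
      ≡⟨ height-φ-combination Q u v w₀ w₁ w₂ (+ n₁) (+ n₂) (+ n₃) ⟩
    + 0 ∎
    where open ≡-Reasoning

∣det2-Tri∣ : ∀ b → ∣ det2 (Tri b 0F) (Tri b 1F) (Tri b 2F) ∣ ≡ 2 ℕ.* b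
∣det2-Tri∣ b = begin
  ∣ det2 (Tri b 0F) (Tri b 1F) (Tri b 2F) ∣ ≡⟨ cong ∣_∣ (rule (+ b)) ⟩
  ∣ - (+ 2 * + b) ∣                         ≡⟨ ℤ.∣-i∣≡∣i∣ (+ 2 * + b) ⟩
  ∣ + 2 * + b ∣                             ≡⟨ ℤ.abs-* (+ 2) (+ b) ⟩
  2 ℕ.* b                                   ∎
  where
  open ≡-Reasoning
  rule : ∀ B → (+ 0 - B) * (+ 1 - + 0) - (- + 1 - + 0) * (+ 0 - B) ≡ - (+ 2 * B)
  rule = solve-∀

cramer-in-plane : ∀ Q u v W Y → height Q u v Y ≡ + 0 →
  dot (cross u v) W ·₃ (Y -₃ Q) ≡ det3 (Y -₃ Q) v W ·₃ u +₃ det3 u (Y -₃ Q) W ·₃ v +₃ + 0 ·₃ W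
cramer-in-plane Q u v W Y hY≡0 = begin
  dot (cross u v) W ·₃ Z                             ≡⟨ cong (_·₃ Z) (det3≡dot-cross u v W) ⟨
  det3 u v W ·₃ Z                                    ≡⟨ cramer u v W Z ⟩
  det3 Z v W ·₃ u +₃ det3 u Z W ·₃ v +₃ det3 u v Z ·₃ W
    ≡⟨ cong (λ t → det3 Z v W ·₃ u +₃ det3 u Z W ·₃ v +₃ t ·₃ W) (trans (det3≡dot-cross u v Z) hY≡0) ⟩
  det3 Z v W ·₃ u +₃ det3 u Z W ·₃ v +₃ + 0 ·₃ W     ∎
  where
  open ≡-Reasoning
  Z = Y -₃ Q

-- 2Bδ² times the barycentric coordinates of Q + (a u + c v)/δ with respect to
-- φ(B,0), φ(0,-1), φ(0,1).
Tri-barycentric : ℤ → ℤ → ℤ → ℤ → Fin 3 → ℤ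
Tri-barycentric B δ a c 0F = + 2 * (δ * a)
Tri-barycentric B δ a c 1F = B * (δ * δ) - δ * a - B * (δ * c)
Tri-barycentric B δ a c 2F = B * (δ * δ) - δ * a + B * (δ * c)

Tri-barycentric-sum : ∀ B δ a c →
  Tri-barycentric B δ a c 0F + Tri-barycentric B δ a c 1F + Tri-barycentric B δ a c 2F ≡ + 2 * B * (δ * δ)
Tri-barycentric-sum B δ a c = rule B δ a c
  where
  rule : ∀ B δ a c →
    + 2 * (δ * a) + (B * (δ * δ) - δ * a - B * (δ * c)) + (B * (δ * δ) - δ * a + B * (δ * c))
    ≡ + 2 * B * (δ * δ)
  rule = solve-∀

Tri-barycentric-combination : ∀ Q u v W Y B δ a c → δ ·₃ (Y -₃ Q) ≡ a ·₃ u +₃ c ·₃ v +₃ + 0 ·₃ W →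
  (+ 2 * B * (δ * δ)) ·₃ Y
  ≡ Tri-barycentric B δ a c 0F ·₃ φ Q u v (v2 B (+ 0)) +₃ Tri-barycentric B δ a c 1F ·₃ φ Q u v (v2 (+ 0) (- + 1))
    +₃ Tri-barycentric B δ a c 2F ·₃ φ Q u v (v2 (+ 0) (+ 1))
Tri-barycentric-combination (v3 Q₁ Q₂ Q₃) (v3 u₁ u₂ u₃) (v3 v₁ v₂ v₃) (v3 w₁ w₂ w₃) (v3 Y₁ Y₂ Y₃) B δ a c plane =
  trans (cong₃ v3 (split B δ Q₁ Y₁) (split B δ Q₂ Y₂) (split B δ Q₃ Y₃))
        (trans (cong (λ Z → (+ 2 * B * (δ * δ)) ·₃ v3 Q₁ Q₂ Q₃ +₃ (+ 2 * B * δ) ·₃ Z) plane)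
               (cong₃ v3 (rule Q₁ u₁ v₁ w₁ B δ a c) (rule Q₂ u₂ v₂ w₂ B δ a c) (rule Q₃ u₃ v₃ w₃ B δ a c)))
  where
  split : ∀ B δ Q Y → + 2 * B * (δ * δ) * Y ≡ + 2 * B * (δ * δ) * Q + + 2 * B * δ * (δ * (Y - Q))
  split = solve-∀
  rule : ∀ Q u v w B δ a c →
    + 2 * B * (δ * δ) * Q + + 2 * B * δ * (a * u + c * v + + 0 * w)
    ≡ + 2 * (δ * a) * (Q + B * u + + 0 * v) + (B * (δ * δ) - δ * a - B * (δ * c)) * (Q + + 0 * u + - + 1 * v)
      + (B * (δ * δ) - δ * a + B * (δ * c)) * (Q + + 0 * u + + 1 * v)
  rule = solve-∀

unit-sign : ∀ k → ∃[ ε ] ε * ε ≡ + 1 × k ≡ ε * + ∣ k ∣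
unit-sign (+ n)    = + 1 , refl , sym (ℤ.*-identityˡ (+ n))
unit-sign -[1+ n ] = - + 1 , refl , sym (ℤ.-1*i≡-i (+ suc n))

∣i∣≡1⇒i*i≡1 : ∀ {i} → ∣ i ∣ ≡ 1 → i * i ≡ + 1
∣i∣≡1⇒i*i≡1 {+ 1}      _ = refl
∣i∣≡1⇒i*i≡1 { -[1+ 0 ]} _ = refl

*-cancel-unit : ∀ {ε a c} → ε * ε ≡ + 1 → a * ε ≡ c * ε → a ≡ c
*-cancel-unit {ε} {a} {c} ε²≡1 eq = begin
  a               ≡⟨ ℤ.*-identityʳ a ⟨
  a * + 1         ≡⟨ cong (a *_) ε²≡1 ⟨
  a * (ε * ε)     ≡⟨ ℤ.*-assoc a ε ε ⟨
  a * ε * ε       ≡⟨ cong (_* ε) eq ⟩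
  c * ε * ε       ≡⟨ ℤ.*-assoc c ε ε ⟩
  c * (ε * ε)     ≡⟨ cong (c *_) ε²≡1 ⟩
  c * + 1         ≡⟨ ℤ.*-identityʳ c ⟩
  c               ∎
  where open ≡-Reasoning

*-unit-twice : ∀ {ε} → ε * ε ≡ + 1 → ∀ L → ε * L * ε ≡ L
*-unit-twice {ε} ε²≡1 L = begin
  ε * L * ε       ≡⟨ rule ε L ⟩
  L * (ε * ε)     ≡⟨ cong (L *_) ε²≡1 ⟩
  L * + 1         ≡⟨ ℤ.*-identityʳ L ⟩
  L               ∎
  where
  open ≡-Reasoning
  rule : ∀ ε L → ε * L * ε ≡ L * (ε * ε)
  rule = solve-∀

pos-2*b*n : ∀ b n → + (2 ℕ.* b ℕ.* n) ≡ + 2 * + b * + n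
pos-2*b*n b n = trans (ℤ.pos-* (2 ℕ.* b) n) (cong (_* + n) (ℤ.pos-* 2 b))

square-positive : ∀ {δ} → δ ≢ + 0 → ∃[ n ] δ * δ ≡ + suc n
square-positive {+ 0}      δ≢0 = contradiction refl δ≢0
square-positive {+[1+ n ]} _   = _ , refl
square-positive { -[1+ n ]} _  = _ , refl

2bδ²-positive : ∀ b .{{_ : ℕ.NonZero b}} δ → δ ≢ + 0 → ∃[ d ] + 2 * + b * (δ * δ) ≡ + suc d
2bδ²-positive b δ δ≢0 = ℕ.pred D , (begin
  + 2 * + b * (δ * δ)  ≡⟨ cong (+ 2 * + b *_) δ²≡1+n ⟩
  + 2 * + b * + suc n  ≡⟨ pos-2*b*n b (suc n) ⟨
  + D                  ≡⟨ cong +_ (ℕ.suc-pred D {{ℕ.m*n≢0 (2 ℕ.* b) (suc n) {{ℕ.m*n≢0 2 b}}}}) ⟨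
  + suc (ℕ.pred D)     ∎)
  where
  open ≡-Reasoning
  n = proj₁ (square-positive δ≢0)
  δ²≡1+n = proj₂ (square-positive δ≢0)
  D = 2 ℕ.* b ℕ.* suc n

a+b*k≤b*L : ∀ {a b k L} → 2 ≤ b → a ≤ L → 2 ℕ.* k ≤ L → a ℕ.+ b ℕ.* k ≤ b ℕ.* L
a+b*k≤b*L {a} {b} {k} {L} 2≤b a≤L 2k≤L = ℕ.*-cancelˡ-≤ 2 (begin
  2 ℕ.* (a ℕ.+ b ℕ.* k)       ≡⟨ expand a b k ⟩
  2 ℕ.* a ℕ.+ b ℕ.* (2 ℕ.* k) ≤⟨ ℕ.+-mono-≤ (ℕ.≤-trans (ℕ.*-monoʳ-≤ 2 a≤L) (ℕ.*-monoˡ-≤ L 2≤b))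
                                            (ℕ.*-monoʳ-≤ b 2k≤L) ⟩
  b ℕ.* L ℕ.+ b ℕ.* L         ≡⟨ double (b ℕ.* L) ⟩
  2 ℕ.* (b ℕ.* L)             ∎)
  where
  open ℕ.≤-Reasoning
  expand : ∀ a b k → 2 ℕ.* (a ℕ.+ b ℕ.* k) ≡ 2 ℕ.* a ℕ.+ b ℕ.* (2 ℕ.* k)
  expand = NS.solve-∀
  double : ∀ n → n ℕ.+ n ≡ 2 ℕ.* n
  double = NS.solve-∀

a+b*0≤b*[l∸2] : ∀ {a b l} → 2 ≤ b → 2 ℕ.< l → a ℕ.< l → a ℕ.+ b ℕ.* 0 ≤ b ℕ.* (l ℕ.∸ 2)
a+b*0≤b*[l∸2] {a} {b} {suc (suc (suc n))} 2≤b (ℕ.s≤s (ℕ.s≤s (ℕ.s≤s _))) (ℕ.s≤s a≤2+n) = begin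
  a ℕ.+ b ℕ.* 0     ≡⟨ cong (a ℕ.+_) (ℕ.*-zeroʳ b) ⟩
  a ℕ.+ 0           ≡⟨ ℕ.+-identityʳ a ⟩
  a                 ≤⟨ a≤2+n ⟩
  2 ℕ.+ n           ≤⟨ ℕ.m≤m+n (2 ℕ.+ n) n ⟩
  2 ℕ.+ n ℕ.+ n     ≡⟨ double n ⟩
  2 ℕ.* suc n       ≤⟨ ℕ.*-monoˡ-≤ (suc n) 2≤b ⟩
  b ℕ.* suc n       ∎
  where
  open ℕ.≤-Reasoning
  double : ∀ n → 2 ℕ.+ n ℕ.+ n ≡ 2 ℕ.* suc n
  double = NS.solve-∀

<2⇒≢0⇒≡1 : ∀ {n} → n ℕ.< 2 → n ≢ 0 → n ≡ 1
<2⇒≢0⇒≡1 {0} _ n≢0 = contradiction refl n≢0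
<2⇒≢0⇒≡1 {1} _ _ = refl
<2⇒≢0⇒≡1 {suc (suc n)} (ℕ.s≤s (ℕ.s≤s ())) _

Odd : ℤ → Set
Odd t = ∃[ k ] t ≡ + 1 + + 2 * k

odd-by-residue : ∀ t q → - t ≡ + 1 + q * + 2 → Odd t
odd-by-residue t q -t≡1+2q = - + 1 - q , (begin
  t                      ≡⟨ ℤ.neg-involutive t ⟨
  - - t                  ≡⟨ cong -_ -t≡1+2q ⟩
  - (+ 1 + q * + 2)      ≡⟨ rule q ⟩
  + 1 + + 2 * (- + 1 - q) ∎)
  where
  open ≡-Reasoning
  rule : ∀ q → - (+ 1 + q * + 2) ≡ + 1 + + 2 * (- + 1 - q)
  rule = solve-∀

-- The standard pyramid

standard : ℕ → ℤ → ℤ → ℕ → Pyramid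
standard b α β l = pyr (v3 α β (+ l)) (lift (Tri b 0F)) (lift (Tri b 1F)) (lift (Tri b 2F))

base-standard : ∀ b α β l j → base (standard b α β l) j ≡ lift (Tri b j)
base-standard b α β l 0F = refl
base-standard b α β l 1F = refl
base-standard b α β l 2F = refl

EmptyAboveFloor : Pyramid → Set
EmptyAboveFloor P = ∀ X → InPyramid P X → X ≡ O P ⊎ z X ≡ + 0

InPyramid-intro : ∀ {P X} D .{{_ : ℕ.NonZero D}} n₀ n₁ n₂ n₃ → n₀ ℕ.+ n₁ ℕ.+ n₂ ℕ.+ n₃ ≡ D →
  + D ·₃ X ≡ + n₀ ·₃ O P +₃ + n₁ ·₃ A P +₃ + n₂ ·₃ B P +₃ + n₃ ·₃ C P → InPyramid P X
InPyramid-intro (suc d) n₀ n₁ n₂ n₃ sum eq = d , n₀ , n₁ , n₂ , n₃ , sum , eq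

standard-weights : ∀ B R L α β X Y E →
  (+ 2 * B) ·₃ (R ·₃ v3 α β L +₃ v3 X Y (+ 0))
  ≡ ((+ 2 * B) * R) ·₃ v3 α β L +₃ (+ 2 * X) ·₃ v3 B (+ 0) (+ 0) +₃ E ·₃ v3 (+ 0) (- + 1) (+ 0)
    +₃ (E + (+ 2 * B) * Y) ·₃ v3 (+ 0) (+ 1) (+ 0)
standard-weights B R L α β X Y E = cong₃ v3 (rule₁ B R α X Y E) (rule₂ B R β X Y E) (rule₃ B R L X Y E)
  where
  rule₁ : ∀ B R α X Y E →
    (+ 2 * B) * (R * α + X) ≡ (+ 2 * B) * R * α + (+ 2 * X) * B + E * + 0 + (E + (+ 2 * B) * Y) * + 0
  rule₁ = solve-∀
  rule₂ : ∀ B R β X Y E →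
    (+ 2 * B) * (R * β + Y) ≡ (+ 2 * B) * R * β + (+ 2 * X) * + 0 + E * (- + 1) + (E + (+ 2 * B) * Y) * + 1
  rule₂ = solve-∀
  rule₃ : ∀ B R L X Y E →
    (+ 2 * B) * (R * L + + 0) ≡ (+ 2 * B) * R * L + (+ 2 * X) * + 0 + E * + 0 + (E + (+ 2 * B) * Y) * + 0
  rule₃ = solve-∀

-- A point X with l X = r (α, β, l) + (x, y, 0) lies on the segment from the apex to (x, y, 0)/(l - r);
-- its weights are 2bl times the barycentric coordinates, and those of the floor point are
-- 2x, b(l - r) - x - by and b(l - r) - x + by, nonnegative when x + b|y| ≤ b(l - r).
module _ (b : ℕ) .{{_ : ℕ.NonZero b}} {α β : ℤ} (r : ℕ) .{{_ : ℕ.NonZero r}} (s x k : ℕ) where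
  private
    L = r ℕ.+ s
    apex = v3 α β (+ L)
    e = b ℕ.* s ℕ.∸ (x ℕ.+ b ℕ.* k)

    instance
      nonZero : ℕ.NonZero (2 ℕ.* b ℕ.* L)
      nonZero = ℕ.m*n≢0 (2 ℕ.* b) L {{ℕ.m*n≢0 2 b}}
        {{ℕ.>-nonZero (ℕ.<-≤-trans (ℕ.>-nonZero⁻¹ r) (ℕ.m≤m+n r s))}}

    weight-sum : x ℕ.+ b ℕ.* k ≤ b ℕ.* s → ∀ {n} →
      n ≡ 2 ℕ.* b ℕ.* r ℕ.+ 2 ℕ.* (e ℕ.+ (x ℕ.+ b ℕ.* k)) → n ≡ 2 ℕ.* b ℕ.* L
    weight-sum fits eq =
      trans eq (trans (cong (λ t → 2 ℕ.* b ℕ.* r ℕ.+ 2 ℕ.* t) (ℕ.m∸n+n≡m fits)) (distribute b r s))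
      where
      distribute : ∀ b r s → 2 ℕ.* b ℕ.* r ℕ.+ 2 ℕ.* (b ℕ.* s) ≡ 2 ℕ.* b ℕ.* (r ℕ.+ s)
      distribute = NS.solve-∀

    weighted : ∀ {X y} E → + L ·₃ X ≡ + r ·₃ apex +₃ v3 (+ x) y (+ 0) →
      + (2 ℕ.* b ℕ.* L) ·₃ X
      ≡ (+ 2 * + b * + r) ·₃ apex +₃ (+ 2 * + x) ·₃ lift (Tri b 0F) +₃ E ·₃ lift (Tri b 1F)
        +₃ (E + + 2 * + b * y) ·₃ lift (Tri b 2F)
    weighted {X} {y} E lX = begin
      + (2 ℕ.* b ℕ.* L) ·₃ X                              ≡⟨ pos-*-·₃ (2 ℕ.* b) L X ⟩
      + (2 ℕ.* b) ·₃ (+ L ·₃ X)                           ≡⟨ cong₂ _·₃_ (ℤ.pos-* 2 b) lX ⟩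
      (+ 2 * + b) ·₃ (+ r ·₃ apex +₃ v3 (+ x) y (+ 0))    ≡⟨ standard-weights (+ b) (+ r) (+ L) α β (+ x) y E ⟩
      _                                                   ∎
      where open ≡-Reasoning

  standard-member : ∀ {l X y} → r ℕ.+ s ≡ l → x ℕ.+ b ℕ.* k ≤ b ℕ.* s → y ≡ + k ⊎ y ≡ - + k →
    + l ·₃ X ≡ + r ·₃ v3 α β (+ l) +₃ v3 (+ x) y (+ 0) → InPyramid (standard b α β l) X
  standard-member refl fits (inj₁ refl) lX =
    InPyramid-intro (2 ℕ.* b ℕ.* L) (2 ℕ.* b ℕ.* r) (2 ℕ.* x) e (e ℕ.+ 2 ℕ.* b ℕ.* k)
      (weight-sum fits (regroup b r x e k))
      (trans (weighted (+ e) lX)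
        (sym (cong₃ (λ c₀ c₁ c₃ → c₀ ·₃ apex +₃ c₁ ·₃ lift (Tri b 0F) +₃ + e ·₃ lift (Tri b 1F)
                                  +₃ c₃ ·₃ lift (Tri b 2F))
                    (pos-2*b*n b r) (ℤ.pos-* 2 x) (cong (_+_ (+ e)) (pos-2*b*n b k)))))
    where
    regroup : ∀ b r x e k → 2 ℕ.* b ℕ.* r ℕ.+ 2 ℕ.* x ℕ.+ e ℕ.+ (e ℕ.+ 2 ℕ.* b ℕ.* k)
                            ≡ 2 ℕ.* b ℕ.* r ℕ.+ 2 ℕ.* (e ℕ.+ (x ℕ.+ b ℕ.* k))
    regroup = NS.solve-∀
  standard-member refl fits (inj₂ refl) lX =
    InPyramid-intro (2 ℕ.* b ℕ.* L) (2 ℕ.* b ℕ.* r) (2 ℕ.* x) (e ℕ.+ 2 ℕ.* b ℕ.* k) e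
      (weight-sum fits (regroup b r x e k))
      (trans (weighted (+ (e ℕ.+ 2 ℕ.* b ℕ.* k)) lX)
        (sym (cong₃ (λ c₀ c₁ c₃ → c₀ ·₃ apex +₃ c₁ ·₃ lift (Tri b 0F)
                                  +₃ + (e ℕ.+ 2 ℕ.* b ℕ.* k) ·₃ lift (Tri b 1F) +₃ c₃ ·₃ lift (Tri b 2F))
                    (pos-2*b*n b r) (ℤ.pos-* 2 x) cancel)))
    where
    regroup : ∀ b r x e k → 2 ℕ.* b ℕ.* r ℕ.+ 2 ℕ.* x ℕ.+ (e ℕ.+ 2 ℕ.* b ℕ.* k) ℕ.+ e
                            ≡ 2 ℕ.* b ℕ.* r ℕ.+ 2 ℕ.* (e ℕ.+ (x ℕ.+ b ℕ.* k))
    regroup = NS.solve-∀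
    cancel : + e ≡ + e + + (2 ℕ.* b ℕ.* k) + + 2 * + b * - + k
    cancel = trans (rule (+ e) (+ b) (+ k)) (cong (λ t → + e + t + + 2 * + b * - + k) (sym (pos-2*b*n b k)))
      where
      rule : ∀ E B K → E ≡ E + + 2 * B * K + + 2 * B * - K
      rule = solve-∀

-- With x, y residues of -rα, -rβ modulo l, the point of standard-member has integer
-- coordinates; at height 1 it lies in the pyramid unless -α ≢ 0 and -β ≡ l/2 (mod l), and then
-- at height 2 unless l = 2.
module _ (b : ℕ) (2≤b : 2 ≤ b) {α β : ℤ} {l : ℕ} (1<l : 1 ℕ.< l)
         (empty : EmptyAboveFloor (standard b α β l)) where
  private
    instance
      b≢0 : ℕ.NonZero b
      b≢0 = ℕ.>-nonZero (ℕ.<-≤-trans (ℕ.s≤s ℕ.z≤n) 2≤b)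
      l≢0 : ℕ.NonZero l
      l≢0 = ℕ.>-nonZero (ℕ.<-trans (ℕ.s≤s ℕ.z≤n) 1<l)

    no-point-between : ∀ r .{{_ : ℕ.NonZero r}} s x k {P′ Q′ y} → 0 ℕ.< s → r ℕ.+ s ≡ l →
      x ℕ.+ b ℕ.* k ≤ b ℕ.* s → y ≡ + k ⊎ y ≡ - + k →
      + l * P′ ≡ + r * α + + x → + l * Q′ ≡ + r * β + y → ⊥
    no-point-between r s x k {P′} {Q′} 0<s r+s≡l fits y≡±k lP′ lQ′ =
      [ (λ X≡apex → ℕ.<-irrefl (ℤ.+-injective (cong z X≡apex)) (subst (r ℕ.<_) r+s≡l (ℕ.m<m+n r 0<s)))
      , (λ r≡0 → ℕ.≢-nonZero⁻¹ r (ℤ.+-injective r≡0))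
      ]′ (empty (v3 P′ Q′ (+ r))
                (standard-member b r s x k r+s≡l fits y≡±k (cong₃ v3 lP′ lQ′ (rule (+ l) (+ r)))))
      where
      rule : ∀ L R → L * R ≡ R * L + + 0
      rule = solve-∀

    residue : ℤ → ℕ
    residue u = (- u) ℤ.%ℕ l

    rounded : ℤ → ℤ
    rounded u = - ((- u) ℤ./ℕ l)

    l*rounded : ∀ u → + l * rounded u ≡ u + + residue u
    l*rounded u = begin
      + l * rounded u                  ≡⟨ rule₁ (+ l) (+ residue u) ((- u) ℤ./ℕ l) ⟩
      + residue u - (+ residue u + (- u) ℤ./ℕ l * + l)
                                       ≡⟨ cong (_-_ (+ residue u)) (DM.a≡a%ℕn+[a/ℕn]*n (- u) l) ⟨
      + residue u - - u                ≡⟨ rule₂ (+ residue u) u ⟩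
      u + + residue u                  ∎
      where
      open ≡-Reasoning
      rule₁ : ∀ L x q → L * - q ≡ x - (x + q * L)
      rule₁ = solve-∀
      rule₂ : ∀ x u → x - - u ≡ u + x
      rule₂ = solve-∀

    residue<l : ∀ u → residue u ℕ.< l
    residue<l u = DM.n%ℕd<d (- u) l

    a c : ℕ
    a = residue (+ 1 * α)
    c = residue (+ 1 * β)

    fits-at-height-one : ∀ {x k} → x ℕ.< l → 2 ℕ.* k ℕ.< l → x ℕ.+ b ℕ.* k ≤ b ℕ.* ℕ.pred l
    fits-at-height-one x<l 2k<l = a+b*k≤b*L 2≤b (ℕ.<⇒≤pred x<l) (ℕ.<⇒≤pred 2k<l)

    no-point-at-height-one : ∀ x k {P′ Q′ y} → x ℕ.+ b ℕ.* k ≤ b ℕ.* ℕ.pred l → y ≡ + k ⊎ y ≡ - + k →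
      + l * P′ ≡ + 1 * α + + x → + l * Q′ ≡ + 1 * β + y → ⊥
    no-point-at-height-one x k = no-point-between 1 (ℕ.pred l) x k (ℕ.<⇒≤pred 1<l) (ℕ.suc-pred l)

    α-residue≢0 : a ≢ 0
    α-residue≢0 a≡0 = no-point-at-height-one 0 c (ℕ.*-monoʳ-≤ b (ℕ.<⇒≤pred (residue<l (+ 1 * β)))) (inj₁ refl)
      (trans (l*rounded (+ 1 * α)) (cong (λ n → + 1 * α + + n) a≡0)) (l*rounded (+ 1 * β))

    2c≡l : 2 ℕ.* c ≡ l
    2c≡l with ℕ.<-cmp (2 ℕ.* c) l
    ... | tri< 2c<l _ _ = ⊥-elim (no-point-at-height-one a c (fits-at-height-one (residue<l (+ 1 * α)) 2c<l)
                                    (inj₁ refl) (l*rounded (+ 1 * α)) (l*rounded (+ 1 * β)))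
    ... | tri≈ _ 2c≡l _ = 2c≡l
    ... | tri> _ _ l<2c = ⊥-elim (no-point-at-height-one a (l ℕ.∸ c)
                                    (fits-at-height-one (residue<l (+ 1 * α)) 2[l∸c]<l)
                                    (inj₂ refl) (l*rounded (+ 1 * α)) lQ)
      where
      c≤l : c ≤ l
      c≤l = ℕ.<⇒≤ (residue<l (+ 1 * β))
      2[l∸c]<l : 2 ℕ.* (l ℕ.∸ c) ℕ.< l
      2[l∸c]<l = ℕ.+-cancelʳ-< (2 ℕ.* c) (2 ℕ.* (l ℕ.∸ c)) l
        (subst (ℕ._< l ℕ.+ 2 ℕ.* c) (trans (double l) (trans (cong (2 ℕ.*_) (sym (ℕ.m∸n+n≡m c≤l)))
                                                             (distribute (l ℕ.∸ c) c)))
               (ℕ.+-monoʳ-< l l<2c))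
        where
        double : ∀ n → n ℕ.+ n ≡ 2 ℕ.* n
        double = NS.solve-∀
        distribute : ∀ m n → 2 ℕ.* (m ℕ.+ n) ≡ 2 ℕ.* m ℕ.+ 2 ℕ.* n
        distribute = NS.solve-∀
      lQ : + l * (rounded (+ 1 * β) - + 1) ≡ + 1 * β + - + (l ℕ.∸ c)
      lQ = begin
        + l * (rounded (+ 1 * β) - + 1)            ≡⟨ rule₁ (+ l) (rounded (+ 1 * β)) ⟩
        + l * rounded (+ 1 * β) - + l
          ≡⟨ cong₂ _-_ (l*rounded (+ 1 * β)) (cong +_ (sym (ℕ.m+[n∸m]≡n c≤l))) ⟩
        (+ 1 * β + + c) - (+ c + + (l ℕ.∸ c))       ≡⟨ rule₂ (+ 1 * β) (+ c) (+ (l ℕ.∸ c)) ⟩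
        + 1 * β + - + (l ℕ.∸ c)                    ∎
        where
        open ≡-Reasoning
        rule₁ : ∀ L Q → L * (Q - + 1) ≡ L * Q - L
        rule₁ = solve-∀
        rule₂ : ∀ B C K → B + C - (C + K) ≡ B + - K
        rule₂ = solve-∀

    l≡2 : l ≡ 2
    l≡2 with ℕ.m≤n⇒m<n∨m≡n 1<l
    ... | inj₂ 2≡l = sym 2≡l
    ... | inj₁ 2<l = ⊥-elim (no-point-between 2 (l ℕ.∸ 2) (residue (+ 2 * α)) 0 (ℕ.m<n⇒0<n∸m 2<l)
                               (ℕ.m+[n∸m]≡n (ℕ.<⇒≤ 2<l)) (a+b*0≤b*[l∸2] 2≤b 2<l (residue<l (+ 2 * α)))
                               (inj₁ refl) (l*rounded (+ 2 * α)) lQ)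
      where
      quotient = (- (+ 1 * β)) ℤ./ℕ l
      l≡2c : + l ≡ + 2 * + c
      l≡2c = trans (cong +_ (sym 2c≡l)) (ℤ.pos-* 2 c)
      lQ : + l * - (+ 1 + + 2 * quotient) ≡ + 2 * β + + 0
      lQ = begin
        + l * - (+ 1 + + 2 * quotient)
          ≡⟨ cong (λ L → L * - (+ 1 + + 2 * quotient)) l≡2c ⟩
        (+ 2 * + c) * - (+ 1 + + 2 * quotient)
          ≡⟨ rule (+ c) quotient ⟩
        + 2 * - (+ c + quotient * (+ 2 * + c)) + + 0
          ≡⟨ cong (λ L → + 2 * - (+ c + quotient * L) + + 0) l≡2c ⟨
        + 2 * - (+ c + quotient * + l) + + 0
          ≡⟨ cong (λ t → + 2 * - t + + 0) (DM.a≡a%ℕn+[a/ℕn]*n (- (+ 1 * β)) l) ⟨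
        + 2 * - - (+ 1 * β) + + 0
          ≡⟨ cong (λ t → + 2 * t + + 0) (trans (ℤ.neg-involutive (+ 1 * β)) (ℤ.*-identityˡ β)) ⟩
        + 2 * β + + 0 ∎
        where
        open ≡-Reasoning
        rule : ∀ C q → (+ 2 * C) * - (+ 1 + + 2 * q) ≡ + 2 * - (C + q * (+ 2 * C)) + + 0
        rule = solve-∀

    odd-if-residue-one : ∀ t → residue (+ 1 * t) ≡ 1 → Odd t
    odd-if-residue-one t residue≡1 = subst Odd (ℤ.*-identityˡ t)
      (odd-by-residue (+ 1 * t) ((- (+ 1 * t)) ℤ./ℕ l)
        (trans (DM.a≡a%ℕn+[a/ℕn]*n (- (+ 1 * t)) l)
               (cong₂ (λ n m → + n + (- (+ 1 * t)) ℤ./ℕ l * + m) residue≡1 l≡2)))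

  standard-shape : l ≡ 2 × Odd α × Odd β
  standard-shape = l≡2
            , odd-if-residue-one α (<2⇒≢0⇒≡1 (subst (a ℕ.<_) l≡2 (residue<l (+ 1 * α))) α-residue≢0)
            , odd-if-residue-one β (ℕ.*-cancelˡ-≡ c 1 2 (trans 2c≡l l≡2))

flip-shear : ℤ → ℤ → M3
flip-shear s t = m3 (v3 (+ 0) (+ 0) (- + 1)) (v3 (+ 0) (+ 1) s) (v3 (+ 1) (+ 0) t)

flip-shear-unimodular : ∀ s t → Unimodular (flip-shear s t)
flip-shear-unimodular s t = m3 (v3 t (+ 0) (+ 1)) (v3 s (+ 1) (+ 0)) (v3 (- + 1) (+ 0) (+ 0)) ,
  (λ { (v3 a c r) → cong₃ v3 (rule₁ s t a c r) (rule₂ s t a c r) (rule₃ s t a c r) }) ,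
  (λ { (v3 a c r) → cong₃ v3 (rule₄ s t a c r) (rule₅ s t a c r) (rule₆ s t a c r) })
  where
  rule₁ : ∀ s t a c r → + 0 * (t * a + + 0 * c + + 1 * r) + + 0 * (s * a + + 1 * c + + 0 * r)
                        + - + 1 * (- + 1 * a + + 0 * c + + 0 * r) ≡ a
  rule₁ = solve-∀
  rule₂ : ∀ s t a c r → + 0 * (t * a + + 0 * c + + 1 * r) + + 1 * (s * a + + 1 * c + + 0 * r)
                        + s * (- + 1 * a + + 0 * c + + 0 * r) ≡ c
  rule₂ = solve-∀
  rule₃ : ∀ s t a c r → + 1 * (t * a + + 0 * c + + 1 * r) + + 0 * (s * a + + 1 * c + + 0 * r)
                        + t * (- + 1 * a + + 0 * c + + 0 * r) ≡ r
  rule₃ = solve-∀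
  rule₄ : ∀ s t a c r → t * (+ 0 * a + + 0 * c + - + 1 * r) + + 0 * (+ 0 * a + + 1 * c + s * r)
                        + + 1 * (+ 1 * a + + 0 * c + t * r) ≡ a
  rule₄ = solve-∀
  rule₅ : ∀ s t a c r → s * (+ 0 * a + + 0 * c + - + 1 * r) + + 1 * (+ 0 * a + + 1 * c + s * r)
                        + + 0 * (+ 1 * a + + 0 * c + t * r) ≡ c
  rule₅ = solve-∀
  rule₆ : ∀ s t a c r → - + 1 * (+ 0 * a + + 0 * c + - + 1 * r) + + 0 * (+ 0 * a + + 1 * c + s * r)
                        + + 0 * (+ 1 * a + + 0 * c + t * r) ≡ r
  rule₆ = solve-∀

flip-shear-app : ∀ s t a c r → app (flip-shear s t) (v3 a c r) ≡ v3 (- r) (c + s * r) (a + t * r)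
flip-shear-app s t a c r = cong₃ v3 (rule₁ a c r) (rule₂ s a c r) (rule₃ t a c r)
  where
  rule₁ : ∀ a c r → + 0 * a + + 0 * c + - + 1 * r ≡ - r
  rule₁ = solve-∀
  rule₂ : ∀ s a c r → + 0 * a + + 1 * c + s * r ≡ c + s * r
  rule₂ = solve-∀
  rule₃ : ∀ t a c r → + 1 * a + + 0 * c + t * r ≡ a + t * r
  rule₃ = solve-∀

flip-shear-floor : ∀ s t w → app (flip-shear s t) (lift w) ≡ v3 (+ 0) (q w) (p w)
flip-shear-floor s t (v2 a c) = trans (flip-shear-app s t a c (+ 0)) (cong₃ v3 refl (vanish s c) (vanish t a))
  where
  vanish : ∀ k a → a + k * + 0 ≡ a
  vanish k a = trans (cong (_+_ a) (ℤ.*-zeroʳ k)) (ℤ.+-identityʳ a)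

swap₁₂ : Fin 3 → Fin 3
swap₁₂ 0F = 0F
swap₁₂ 1F = 2F
swap₁₂ 2F = 1F

swap₁₂-involutive : ∀ i → swap₁₂ (swap₁₂ i) ≡ i
swap₁₂-involutive 0F = refl
swap₁₂-involutive 1F = refl
swap₁₂-involutive 2F = refl

swap₁₂-injective : Injective _≡_ _≡_ swap₁₂
swap₁₂-injective {i} {j} eq =
  trans (sym (swap₁₂-involutive i)) (trans (cong swap₁₂ eq) (swap₁₂-involutive j))

standard≅U : ∀ b {α β} → Odd α → Odd β → PyrEquiv (standard b α β 2) (U b)
standard≅U b {α} {β} (i , α≡1+2i) (j , β≡1+2j) =
  flip-shear s t , flip-shear-unimodular s t , shift ,
  trans (cong (_+₃ shift) (flip-shear-app s t α β (+ 2))) (cong₃ v3 refl apex-y apex-z) ,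
  swap₁₂ , swap₁₂-injective , base-image
  where
  s = - + 1 - j
  t = - i
  shift = v3 (+ 2) (+ 1) (- + 1)
  apex-y : β + s * + 2 + + 1 ≡ + 0
  apex-y = trans (cong (λ β → β + s * + 2 + + 1) β≡1+2j) (rule j)
    where
    rule : ∀ j → + 1 + + 2 * j + (- + 1 - j) * + 2 + + 1 ≡ + 0
    rule = solve-∀
  apex-z : α + t * + 2 + - + 1 ≡ + 0
  apex-z = trans (cong (λ α → α + t * + 2 + - + 1) α≡1+2i) (rule i)
    where
    rule : ∀ i → + 1 + + 2 * i + - i * + 2 + - + 1 ≡ + 0
    rule = solve-∀
  base-image : ∀ k → app (flip-shear s t) (base (standard b α β 2) k) +₃ shift ≡ base (U b) (swap₁₂ k)
  base-image 0F = cong (_+₃ shift) (flip-shear-floor s t (Tri b 0F))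
  base-image 1F = cong (_+₃ shift) (flip-shear-floor s t (Tri b 1F))
  base-image 2F = cong (_+₃ shift) (flip-shear-floor s t (Tri b 2F))

-- Pyramids over the image of Tri b

module PyramidOverTri (b : ℕ) (2≤b : 2 ≤ b) (O Q u v : V3) (σ : Fin 3 → Fin 3)
               (σ-injective : Injective _≡_ _≡_ σ) where

  vertex : Fin 3 → V3
  vertex j = φ Q u v (Tri b j)

  P : Pyramid
  P = pyr O (vertex (σ 0F)) (vertex (σ 1F)) (vertex (σ 2F))

  h : V3 → ℤ
  h = height Q u v

  π : IsPerm (σ 0F) (σ 1F) (σ 2F)
  π = injective⇒IsPerm σ σ-injective

  private
    instance
      b≢0 : ℕ.NonZero b
      b≢0 = ℕ.>-nonZero (ℕ.<-≤-trans (ℕ.s≤s ℕ.z≤n) 2≤b)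
      2b≢0 : ℕ.NonZero (2 ℕ.* b)
      2b≢0 = ℕ.m*n≢0 2 b

  planeVal≡ : ∀ X → planeVal P X ≡ 2 ℕ.* b ℕ.* ∣ h X ∣
  planeVal≡ X = trans (planeVal-φ O Q u v (Tri b (σ 0F)) (Tri b (σ 1F)) (Tri b (σ 2F)) X)
                      (cong (ℕ._* ∣ h X ∣) (trans (∣det2∣-permute π (Tri b)) (∣det2-Tri∣ b)))

  module _ (φ-injective : Injective _≡_ _≡_ (φ Q u v))
           (φ-onto : ∀ X → InBasePlane P X → ∃[ w ] φ Q u v w ≡ X)
           (empty : CompletelyEmpty P)
           {l m X₀} (1<l : 1 ℕ.< l) (0<m : 0 ℕ.< m) (planeVal-X₀ : planeVal P X₀ ≡ m)
           (minimal : ∀ X → 0 ℕ.< planeVal P X → m ≤ planeVal P X) (planeVal-O : planeVal P O ≡ l ℕ.* m)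
           where

    private
      instance
        l≢0 : ℕ.NonZero l
        l≢0 = ℕ.>-nonZero (ℕ.<-trans (ℕ.s≤s ℕ.z≤n) 1<l)
        m≢0 : ℕ.NonZero m
        m≢0 = ℕ.>-nonZero 0<m

    h-O≢0 : h O ≢ + 0
    h-O≢0 h-O≡0 = ℕ.≢-nonZero⁻¹ (l ℕ.* m) {{ℕ.m*n≢0 l m}} (begin
      l ℕ.* m                   ≡⟨ planeVal-O ⟨
      planeVal P O              ≡⟨ planeVal≡ O ⟩
      2 ℕ.* b ℕ.* ∣ h O ∣       ≡⟨ cong (λ t → 2 ℕ.* b ℕ.* ∣ t ∣) h-O≡0 ⟩
      2 ℕ.* b ℕ.* 0             ≡⟨ ℕ.*-zeroʳ (2 ℕ.* b) ⟩
      0                         ∎)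
      where open ≡-Reasoning

    -- Cramer's rule with the apex, which lies off the plane, writes Y as a rational affine
    -- combination of the base vertices.
    plane-point : ∀ Y → h Y ≡ + 0 → ∃[ w ] φ Q u v w ≡ Y
    plane-point Y hY≡0 = φ-onto Y (d , k (σ 0F) , k (σ 1F) , k (σ 2F) , weight-sum , combination)
      where
      δ = h O
      W₀ = O -₃ Q
      a = det3 (Y -₃ Q) v W₀
      c = det3 u (Y -₃ Q) W₀
      k = Tri-barycentric (+ b) δ a c
      d = proj₁ (2bδ²-positive b δ h-O≢0)
      D≡1+d = proj₂ (2bδ²-positive b δ h-O≢0)
      weight-sum : k (σ 0F) + k (σ 1F) + k (σ 2F) ≡ + suc d
      weight-sum = trans (∙-permute ℤ.+-commutativeSemigroup π k) (trans (Tri-barycentric-sum (+ b) δ a c) D≡1+d)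
      combination :
        + suc d ·₃ Y ≡ k (σ 0F) ·₃ vertex (σ 0F) +₃ k (σ 1F) ·₃ vertex (σ 1F) +₃ k (σ 2F) ·₃ vertex (σ 2F)
      combination = begin
        + suc d ·₃ Y
          ≡⟨ cong (_·₃ Y) D≡1+d ⟨
        (+ 2 * + b * (δ * δ)) ·₃ Y
          ≡⟨ Tri-barycentric-combination Q u v W₀ Y (+ b) δ a c (cramer-in-plane Q u v W₀ Y hY≡0) ⟩
        k 0F ·₃ vertex 0F +₃ k 1F ·₃ vertex 1F +₃ k 2F ·₃ vertex 2F
          ≡⟨ ∙-permute +₃-commutativeSemigroup π (λ j → k j ·₃ vertex j) ⟨
        k (σ 0F) ·₃ vertex (σ 0F) +₃ k (σ 1F) ·₃ vertex (σ 1F) +₃ k (σ 2F) ·₃ vertex (σ 2F) ∎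
        where open ≡-Reasoning

    g : ℤ
    g = h X₀

    W₁ : V3
    W₁ = X₀ -₃ Q

    g≢0 : g ≢ + 0
    g≢0 g≡0 = ℕ.≢-nonZero⁻¹ m (begin
      m                     ≡⟨ planeVal-X₀ ⟨
      planeVal P X₀         ≡⟨ planeVal≡ X₀ ⟩
      2 ℕ.* b ℕ.* ∣ g ∣     ≡⟨ cong (λ t → 2 ℕ.* b ℕ.* ∣ t ∣) g≡0 ⟩
      2 ℕ.* b ℕ.* 0         ≡⟨ ℕ.*-zeroʳ (2 ℕ.* b) ⟩
      0                     ∎)
      where open ≡-Reasoning

    minimal-height : ∀ X → 0 ℕ.< ∣ h X ∣ → ∣ g ∣ ≤ ∣ h X ∣
    minimal-height X 0<∣hX∣ = ℕ.*-cancelˡ-≤ (2 ℕ.* b)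
      (subst₂ _≤_ (trans (sym planeVal-X₀) (planeVal≡ X₀)) (planeVal≡ X) (minimal X positive))
      where
      positive : 0 ℕ.< planeVal P X
      positive = subst (0 ℕ.<_) (sym (planeVal≡ X))
        (ℕ.>-nonZero⁻¹ (2 ℕ.* b ℕ.* ∣ h X ∣) {{ℕ.m*n≢0 (2 ℕ.* b) ∣ h X ∣ {{2b≢0}} {{ℕ.>-nonZero 0<∣hX∣}}}})

    private
      instance
        g-nonZero : ℤ.NonZero g
        g-nonZero = ℕ.≢-nonZero (g≢0 ∘ ℤ.∣i∣≡0⇒i≡0)

    -- Division of h Y by g leaves a point of smaller height, which lies in the plane by minimality.
    decompose : ∀ Y → ∃[ w ] ∃[ k ] Y ≡ φ Q u v w +₃ k ·₃ W₁
    decompose Y = by-remainder (h Y DM.% g) (h Y DM./ g) (DM.n%d<d (h Y) g) (DM.a≡a%n+[a/n]*n (h Y) g)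
      where
      by-remainder : ∀ r k → r ℕ.< ∣ g ∣ → h Y ≡ + r + k * g → ∃[ w ] ∃[ k ] Y ≡ φ Q u v w +₃ k ·₃ W₁
      by-remainder r k r<∣g∣ hY≡ = remainder-vanishes r r<∣g∣ height-Y′
        where
        Y′ = Y +₃ (- k) ·₃ W₁
        height-Y′ : h Y′ ≡ + r
        height-Y′ = trans (height-translate Q u v Y (- k) W₁) (trans (cong (_+ - k * g) hY≡) (rule (+ r) k g))
          where
          rule : ∀ r q g → r + q * g + - q * g ≡ r
          rule = solve-∀
        remainder-vanishes : ∀ r → r ℕ.< ∣ g ∣ → h Y′ ≡ + r → ∃[ w ] ∃[ k ] Y ≡ φ Q u v w +₃ k ·₃ W₁
        remainder-vanishes 0 _ hY′≡0 =
          let (w , φw≡Y′) = plane-point Y′ hY′≡0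
          in w , k , trans (+₃-·₃-cancel k Y W₁) (cong (_+₃ k ·₃ W₁) (sym φw≡Y′))
        remainder-vanishes (suc r) r<∣g∣ hY′≡1+r = ⊥-elim (ℕ.<⇒≱ r<∣g∣
          (subst (∣ g ∣ ≤_) (cong ∣_∣ hY′≡1+r)
                 (minimal-height Y′ (subst (0 ℕ.<_) (cong ∣_∣ (sym hY′≡1+r)) (ℕ.s≤s ℕ.z≤n)))))

    -- By decompose, u, v and W₁ span ℤ³, so det(u, v, W₁) = g is a unit.
    ∣g∣≡1 : ∣ g ∣ ≡ 1
    ∣g∣≡1 = ℕ.m*n≡1⇒m≡1 ∣ g ∣ ∣ K ∣ (trans (sym (ℤ.abs-* g K)) (cong ∣_∣ gK≡1))
      where
      onto : ∀ Z → ∃[ z ] app (columns u v W₁) z ≡ Z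
      onto Z = let (w , k , eq) = decompose (Q +₃ Z)
               in v3 (p w) (q w) k , +₃-cancelˡ Q (trans (frame-φ Q u v W₁ (p w) (q w) k) (sym eq))
      K = proj₁ (surjective⇒det-unit u v W₁ onto)
      gK≡1 : g * K ≡ + 1
      gK≡1 = trans (cong (_* K) (sym (det3≡dot-cross u v W₁))) (proj₂ (surjective⇒det-unit u v W₁ onto))

    m≡2b : m ≡ 2 ℕ.* b
    m≡2b = trans (sym planeVal-X₀)
                 (trans (planeVal≡ X₀) (trans (cong (2 ℕ.* b ℕ.*_) ∣g∣≡1) (ℕ.*-identityʳ (2 ℕ.* b))))

    ∣h-O∣≡l : ∣ h O ∣ ≡ l
    ∣h-O∣≡l = ℕ.*-cancelˡ-≡ ∣ h O ∣ l (2 ℕ.* b) (begin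
      2 ℕ.* b ℕ.* ∣ h O ∣   ≡⟨ planeVal≡ O ⟨
      planeVal P O          ≡⟨ planeVal-O ⟩
      l ℕ.* m               ≡⟨ cong (l ℕ.*_) m≡2b ⟩
      l ℕ.* (2 ℕ.* b)       ≡⟨ ℕ.*-comm l (2 ℕ.* b) ⟩
      2 ℕ.* b ℕ.* l         ∎)
      where open ≡-Reasoning

    private
      w-O = proj₁ (decompose O)
      k-O = proj₁ (proj₂ (decompose O))
      O≡ : O ≡ φ Q u v w-O +₃ k-O ·₃ W₁
      O≡ = proj₂ (proj₂ (decompose O))

      ∣k-O∣≡l : ∣ k-O ∣ ≡ l
      ∣k-O∣≡l = begin
        ∣ k-O ∣               ≡⟨ ℕ.*-identityʳ ∣ k-O ∣ ⟨
        ∣ k-O ∣ ℕ.* 1         ≡⟨ cong (∣ k-O ∣ ℕ.*_) ∣g∣≡1 ⟨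
        ∣ k-O ∣ ℕ.* ∣ g ∣     ≡⟨ ℤ.abs-* k-O g ⟨
        ∣ k-O * g ∣           ≡⟨ cong ∣_∣ h-O≡ ⟨
        ∣ h O ∣               ≡⟨ ∣h-O∣≡l ⟩
        l                     ∎
        where
        open ≡-Reasoning
        h-O≡ : h O ≡ k-O * g
        h-O≡ = trans (cong h O≡) (trans (height-translate Q u v (φ Q u v w-O) k-O W₁)
                                        (trans (cong (_+ k-O * g) (height-φ Q u v w-O)) (ℤ.+-identityˡ (k-O * g))))

      -- The sign ε puts O at height +l rather than -l in the frame (u, v, ε W₁).
      ε = proj₁ (unit-sign k-O)
      ε²≡1 : ε * ε ≡ + 1
      ε²≡1 = proj₁ (proj₂ (unit-sign k-O))
      k-O≡εl : k-O ≡ ε * + l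
      k-O≡εl = trans (proj₂ (proj₂ (unit-sign k-O))) (cong (λ n → ε * + n) ∣k-O∣≡l)

      W = ε ·₃ W₁
      s = ε * g
      s²≡1 : s * s ≡ + 1
      s²≡1 = begin
        ε * g * (ε * g)      ≡⟨ rule ε g ⟩
        ε * ε * (g * g)      ≡⟨ cong₂ _*_ ε²≡1 (∣i∣≡1⇒i*i≡1 {g} ∣g∣≡1) ⟩
        + 1                  ∎
        where
        open ≡-Reasoning
        rule : ∀ ε g → ε * g * (ε * g) ≡ ε * ε * (g * g)
        rule = solve-∀

      G = columns u v W
      F : V3 → V3
      F z = Q +₃ app G z
      α = p w-O
      β = q w-O

      F-apex : F (v3 α β (+ l)) ≡ O
      F-apex = begin
        F (v3 α β (+ l))                         ≡⟨ frame-φ Q u v W α β (+ l) ⟩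
        φ Q u v w-O +₃ + l ·₃ W                  ≡⟨ cong (λ t → φ Q u v w-O +₃ t ·₃ W) l≡k-Oε ⟩
        φ Q u v w-O +₃ (k-O * ε) ·₃ (ε ·₃ W₁)    ≡⟨ cong (φ Q u v w-O +₃_) (·₃-unit {ε} ε²≡1 k-O W₁) ⟨
        φ Q u v w-O +₃ k-O ·₃ W₁                 ≡⟨ O≡ ⟨
        O                                        ∎
        where
        open ≡-Reasoning
        l≡k-Oε : + l ≡ k-O * ε
        l≡k-Oε = sym (trans (cong (_* ε) k-O≡εl) (*-unit-twice {ε} ε²≡1 (+ l)))

      F-onto : ∀ Y → ∃[ z ] F z ≡ Y
      F-onto Y = let (w , k , Y≡) = decompose Y
                 in v3 (p w) (q w) (k * ε) ,
                    trans (frame-φ Q u v W (p w) (q w) (k * ε))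
                          (trans (cong (φ Q u v w +₃_) (sym (·₃-unit {ε} ε²≡1 k W₁))) (sym Y≡))

      height-F : ∀ a c r → h (F (v3 a c r)) ≡ r * s
      height-F a c r = begin
        h (F (v3 a c r))                                  ≡⟨ cong h (frame-φ Q u v W a c r) ⟩
        h (φ Q u v (v2 a c) +₃ r ·₃ W)                    ≡⟨ height-translate Q u v (φ Q u v (v2 a c)) r W ⟩
        h (φ Q u v (v2 a c)) + r * dot (cross u v) W      ≡⟨ cong₂ (λ t n → t + r * n) (height-φ Q u v (v2 a c))
                                                                                        (dot-·₃ʳ (cross u v) ε W₁) ⟩
        + 0 + r * s                                       ≡⟨ ℤ.+-identityˡ (r * s) ⟩
        r * s                                             ∎
        where open ≡-Reasoning

      F-injective : ∀ {z z′} → F z ≡ F z′ → z ≡ z′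
      F-injective {v3 a c r} {v3 a′ c′ r′} Fz≡Fz′ = cong₃ v3 (cong p w≡w′) (cong q w≡w′) r≡r′
        where
        r≡r′ : r ≡ r′
        r≡r′ = *-cancel-unit {s} s²≡1 (trans (sym (height-F a c r)) (trans (cong h Fz≡Fz′) (height-F a′ c′ r′)))
        w≡w′ : v2 a c ≡ v2 a′ c′
        w≡w′ = φ-injective (+₃-cancelʳ (r′ ·₃ W) (begin
          φ Q u v (v2 a c) +₃ r′ ·₃ W      ≡⟨ cong (λ t → φ Q u v (v2 a c) +₃ t ·₃ W) r≡r′ ⟨
          φ Q u v (v2 a c) +₃ r ·₃ W       ≡⟨ frame-φ Q u v W a c r ⟨
          F (v3 a c r)                     ≡⟨ Fz≡Fz′ ⟩
          F (v3 a′ c′ r′)                  ≡⟨ frame-φ Q u v W a′ c′ r′ ⟩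
          φ Q u v (v2 a′ c′) +₃ r′ ·₃ W    ∎))
          where open ≡-Reasoning

      G-unimodular : Unimodular G
      G-unimodular = bijective⇒unimodular G (λ eq → F-injective (cong (Q +₃_) eq))
        (λ Z → let (z , Fz≡) = F-onto (Q +₃ Z) in z , +₃-cancelˡ Q Fz≡)

      H = proj₁ G-unimodular

      P≅standard : PyrEquiv P (standard b α β l)
      P≅standard = H , (G , proj₂ (proj₂ G-unimodular) , proj₁ (proj₂ G-unimodular)) , t ,
              trans (cong f (sym F-apex)) (f-F (v3 α β (+ l))) , σ , σ-injective , base-image
        where
        t = (- + 1) ·₃ app H Q
        f : V3 → V3
        f X = app H X +₃ t
        f-F : ∀ z → f (F z) ≡ z
        f-F z = begin
          app H (Q +₃ app G z) +₃ t           ≡⟨ cong (_+₃ t) (app-+ H Q (app G z)) ⟩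
          app H Q +₃ app H (app G z) +₃ t     ≡⟨ cong (λ Z → app H Q +₃ Z +₃ t) (proj₂ (proj₂ G-unimodular) z) ⟩
          app H Q +₃ z +₃ t                   ≡⟨ +₃-neg-cancel (app H Q) z ⟩
          z                                   ∎
          where open ≡-Reasoning
        vertex-image : ∀ j → f (vertex j) ≡ base (standard b α β l) j
        vertex-image j = trans (cong f (sym (frame-lift Q u v W (Tri b j))))
                               (trans (f-F (lift (Tri b j))) (sym (base-standard b α β l j)))
        base-image : ∀ i → f (base P i) ≡ base (standard b α β l) (σ i)
        base-image 0F = vertex-image (σ 0F)
        base-image 1F = vertex-image (σ 1F)
        base-image 2F = vertex-image (σ 2F)

      standard-empty : EmptyAboveFloor (standard b α β l)
      standard-empty X X∈standard =
        [ (λ FX≡O → inj₁ (F-injective (trans FX≡O (sym F-apex))))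
        , (λ FX∈base → inj₂ (*-cancel-unit {s} s²≡1 (begin
            z X * s     ≡⟨ height-F (x X) (y X) (z X) ⟨
            h (F X)     ≡⟨ height-inBase O Q u v (Tri b (σ 0F)) (Tri b (σ 1F)) (Tri b (σ 2F)) (F X) FX∈base ⟩
            + 0         ≡⟨ ℤ.*-zeroˡ s ⟨
            + 0 * s     ∎)))
        ]′ (empty (F X) (InPyramid-affine Q G (lift ∘ Tri b) vertex π F-apex
                                           (λ j → frame-lift Q u v W (Tri b j)) X∈standard))
        where open ≡-Reasoning

      shape : l ≡ 2 × Odd α × Odd β
      shape = standard-shape b 2≤b 1<l standard-empty

    two-story-and-≅U : IntDist P 2 × PyrEquiv P (U b)
    two-story-and-≅U =
      subst (IntDist P) l≡2 (m , 0<m , (X₀ , planeVal-X₀) , minimal , planeVal-O) ,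
      PyrEquiv-trans P≅standard
        (subst (λ n → PyrEquiv (standard b α β n) (U b)) (sym l≡2) (standard≅U b α-odd β-odd))
      where
      l≡2 = proj₁ shape
      α-odd = proj₁ (proj₂ shape)
      β-odd = proj₂ (proj₂ shape)

mainTheorem16 : (b : ℕ) → 2 ≤ b → (P : Pyramid) → NonDegenerate P →
    CompletelyEmpty P → Multistory P → BaseEquiv P (Tri b) →
    IntDist P 2 × PyrEquiv P (U b)
mainTheorem16 b 2≤b (pyr O A B C) _ empty (l , (m , 0<m , (X₀ , planeVal-X₀) , minimal , planeVal-O) , 1<l)
              (Q , u , v , φ-injective , φ-onto , σ , σ-injective , φ-base)
  with φ-base 0F | φ-base 1F | φ-base 2F
... | refl | refl | refl =
  PyramidOverTri.two-story-and-≅U b 2≤b O Q u v σ σ-injective φ-injective φ-onto empty {l} {m} {X₀}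
    1<l 0<m planeVal-X₀ minimal planeVal-O
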